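{- For an even integer $d>2$, let $N(d)$ be the smallest integer such that for every $n\ge N(d)$ every optimal binary $(n,M,\{d,d+2\})$-code $C$ is, after a suitable translation $C\mapsto C+y$ ($y\in\{0,1\}^n$), a constant-weight code of weight $\frac{d}{2}+1$. Then $N(4)\le 302$ and $N(6)\le 1685$.
   Context: A binary code of length $n$ is a subset $C\subseteq\{0,1\}^n$ with Hamming distance; $C$ is an $(n,M,\{d_1,d_2\})$-code if $|C|=M$ and the set of distances between distinct codewords is exactly $\{d_1,d_2\}$. A code is optimal if its size equals the maximum size $A_2(n,\{d_1,d_2\})$ of such codes. Addition is modulo 2. -}

module Defs where

open import Data.Bool using (Bool; true; false; _xor_)
open import Data.Nat using (ℕ; zero; suc; _+_; _≤_; _≥_)
open import Data.Vec using (Vec; []; _∷_; zipWith)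
open import Data.List using (List; length; map)
open import Data.List.Membership.Propositional using (_∈_)
open import Data.List.Relation.Unary.All using (All)
open import Data.List.Relation.Unary.Unique.Propositional using (Unique)
open import Data.Product using (_×_; ∃; ∃-syntax; Σ-syntax)
open import Data.Sum using (_⊎_)
open import Relation.Binary.PropositionalEquality using (_≡_; _≢_)

Word : ℕ → Set
Word n = Vec Bool n

wt : ∀ {n} → Word n → ℕ
wt []           = 0
wt (true  ∷ xs) = suc (wt xs)
wt (false ∷ xs) = wt xs

_⊕_ : ∀ {n} → Word n → Word n → Word n
x ⊕ y = zipWith _xor_ x y

dist : ∀ {n} → Word n → Word n → ℕ
dist x y = wt (x ⊕ y)

-- A binary code of length n: a finite set of words, represented as a
-- duplicate-free list (its size is the length of the list).
Code : ℕ → Set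
Code n = List (Word n)

Is2DistCode : ∀ {n} → ℕ → ℕ → Code n → Set
Is2DistCode {n} d₁ d₂ C =
  Unique C ×
  (∀ x y → x ∈ C → y ∈ C → x ≢ y → dist x y ≡ d₁ ⊎ dist x y ≡ d₂) ×
  (∃[ x ] ∃[ y ] (x ∈ C × y ∈ C × x ≢ y × dist x y ≡ d₁)) ×
  (∃[ x ] ∃[ y ] (x ∈ C × y ∈ C × x ≢ y × dist x y ≡ d₂))

Optimal : ∀ {n} → ℕ → ℕ → Code n → Set
Optimal {n} d₁ d₂ C =
  Is2DistCode d₁ d₂ C × (∀ (C' : Code n) → Is2DistCode d₁ d₂ C' → length C' ≤ length C)

translate : ∀ {n} → Word n → Code n → Code n
translate y C = map (λ x → x ⊕ y) C

ConstWeight : ∀ {n} → ℕ → Code n → Set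
ConstWeight w C = All (λ x → wt x ≡ w) C

-- The property defining N(d): for every n ≥ N, every optimal
-- (n,M,{d,d+2})-code is, after a translation, constant weight d/2+1.
-- (Here h = d/2, so d = 2h and the weight is h+1.)
GoodFrom : (h : ℕ) → (N : ℕ) → Set
GoodFrom h N = ∀ n → n ≥ N → (C : Code n) → Optimal (h + h) (h + h + 2) C →
  ∃[ y ] ConstWeight (suc h) (translate y C)

{-# OPTIONS --safe #-}
module Submission where

-- Call a code large if it has more than a certain linear (in n) number of words. Three words at
-- mutual distance 2k have a centre (their coordinatewise majority) at distance k from each of them,
-- around which they are three disjoint k-sets. Counting the remaining words by their traces on these
-- three sets shows that a large code contains three words at mutual distance 2h+2 (take k = h), and
-- that around their centre (k = h+1) all words of a large code have weight h+1 or h-1. Explicit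
-- transversal designs with about n²/9 (h = 2) or n²/36 (h = 3) blocks show that optimal codes are large.
--
-- At most one word z has weight h-1, and it is disjoint from all the blocks, i.e. the words of weight h+1;
-- two blocks meet in at most one point. Suppose z is there, and fix p ∈ z. For three noncollinear points
-- a, b, c, the block {a,b,c} ∪ (z∖p) can be added once every block through a and b trades b for p, every
-- block through b and c trades c for p, and every block through c and a trades a for p. Doing
-- this for two triples far apart adds two words at the cost of z alone, against optimality.

open import Defs
open import Data.Bool using (Bool; true; false; _∧_; _∨_; not; _xor_)
import Data.Bool.Properties as Bool
open import Data.Fin using (Fin; zero; suc)
open import Data.Fin.Properties using (pigeonhole; ¬∀⟶∃¬)
import Data.Fin.Properties as Fin
open import Data.List using (List; []; _∷_; length; map; _++_; filter; concatMap; cartesianProduct; upTo)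
import Data.List as List
open import Data.List.Properties using (length-map; length-++; length-upTo)
open import Data.List.Membership.DecPropositional using (_∈?_)
open import Data.List.Membership.Propositional using (_∈_; _∉_; find)
open import Data.List.Membership.Propositional.Properties
open import Data.List.Relation.Binary.Subset.Propositional using (_⊆_)
open import Data.List.Relation.Unary.All as All using (All; []; _∷_)
import Data.List.Relation.Unary.All.Properties as All
open import Data.List.Relation.Unary.AllPairs as AllPairs using (AllPairs; []; _∷_)
import Data.List.Relation.Unary.AllPairs.Properties as AllPairs
open import Data.List.Relation.Unary.Any as Any using (Any; here; there)
open import Data.List.Relation.Unary.Any.Properties using (lookup-index)
open import Data.List.Relation.Unary.Unique.Propositional using (Unique)
import Data.List.Relation.Unary.Unique.Propositional.Properties as Unique
open import Data.Nat using (ℕ; zero; suc; _+_; _*_; _^_; _∸_; _≤_; _<_; z≤n; s≤s; NonZero)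
open import Data.Nat.DivMod using (_%_; _/_; m≡m%n+[m/n]*n; m%n<n; m*n/n≡m; /-monoˡ-≤)
open import Data.Nat.Properties
open import Data.Nat.Tactic.RingSolver using (solve-∀)
open import Data.Product using (_×_; _,_; proj₁; proj₂; ∃-syntax)
open import Data.Product.Properties using (≡-dec; ,-injective)
open import Data.Sum using (_⊎_; inj₁; inj₂)
open import Data.Unit using (tt)
open import Data.Vec using ([]; _∷_; zipWith; lookup; replicate; _[_]≔_) renaming (_++_ to _⧺_)
open import Data.Vec.Properties using (lookup-zipWith; lookup∘update; lookup∘update′)
import Data.Vec.Properties as Vec
open import Relation.Binary.Definitions using (Tri; tri<; tri≈; tri>)
open import Relation.Binary.PropositionalEquality using (_≡_; _≢_; refl; sym; trans; cong; cong₂; subst; subst₂;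
  module ≡-Reasoning)
open import Relation.Nullary using (¬_; Dec; yes; no; contradiction)
open import Relation.Nullary.Decidable using (¬?; _×-dec_)

-- The linear counts rest on two facts. Words with equal traces differ only outside the three
-- blocks, where they leave room for at most about n/h words. A word whose weight is neither h+1 nor
-- h-1 cannot be disjoint from any block, so a single such word forces every block through its at
-- most 3(h+1) points, and each point lies on at most n/h blocks.
--
-- The form of the exchange is dictated by `p`: every moved block contains it, so moved blocks must
-- be disjoint elsewhere. Blocks on different sides of a triangle meet only in a corner, and the
-- cyclic trade removes this corner from exactly one of them. Two triples are far apart when no
-- block on a side of one meets a block on a side of the other; this excludes a number of points
-- that depends only on h.
--
-- The two new blocks share `z` without `p`, which has h-2 points; hence h ≤ 3, while h ≥ 2 provides
-- `p`. Since both distances must occur in a code, the exchange has to leave two disjoint blocks in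
-- place and create a pair that meets.

private variable
  n h : ℕ
  A B : Set

-- Words and distances

infixr 7 _∩_
infixl 7 _∖_

_∩_ _∪_ _∖_ : Word n → Word n → Word n
_∩_ = zipWith _∧_
_∪_ = zipWith _∨_
_∖_ = zipWith (λ a b → a ∧ not b)

Disjoint : Word n → Word n → Set
Disjoint x y = wt (x ∩ y) ≡ 0

majority : Bool → Bool → Bool → Bool
majority true  b c = b ∨ c
majority false b c = b ∧ c

maj : Word n → Word n → Word n → Word n
maj []       []       []       = []
maj (a ∷ x) (b ∷ y) (c ∷ z) = majority a b c ∷ maj x y z

wt≤n : (x : Word n) → wt x ≤ n
wt≤n []          = z≤n
wt≤n (true ∷ x)  = s≤s (wt≤n x)
wt≤n (false ∷ x) = m≤n⇒m≤1+n (wt≤n x)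

wt-split : (w a : Word n) → wt w ≡ wt (w ∩ a) + wt (w ∖ a)
wt-split []          []          = refl
wt-split (true ∷ w)  (true ∷ a)  = cong suc (wt-split w a)
wt-split (true ∷ w)  (false ∷ a) = trans (cong suc (wt-split w a)) (sym (+-suc _ _))
wt-split (false ∷ w) (true ∷ a)  = wt-split w a
wt-split (false ∷ w) (false ∷ a) = wt-split w a

dist-split : (v w a : Word n) → dist v w ≡ dist (v ∩ a) (w ∩ a) + dist (v ∖ a) (w ∖ a)
dist-split []          []          []          = refl
dist-split (true ∷ v)  (true ∷ w)  (true ∷ a)  = dist-split v w a
dist-split (true ∷ v)  (true ∷ w)  (false ∷ a) = dist-split v w a
dist-split (true ∷ v)  (false ∷ w) (true ∷ a)  = cong suc (dist-split v w a)
dist-split (true ∷ v)  (false ∷ w) (false ∷ a) = trans (cong suc (dist-split v w a)) (sym (+-suc _ _))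
dist-split (false ∷ v) (true ∷ w)  (true ∷ a)  = cong suc (dist-split v w a)
dist-split (false ∷ v) (true ∷ w)  (false ∷ a) = trans (cong suc (dist-split v w a)) (sym (+-suc _ _))
dist-split (false ∷ v) (false ∷ w) (true ∷ a)  = dist-split v w a
dist-split (false ∷ v) (false ∷ w) (false ∷ a) = dist-split v w a

dist-wt : (x y : Word n) → dist x y + 2 * wt (x ∩ y) ≡ wt x + wt y
dist-wt []          []          = refl
dist-wt (true ∷ x)  (true ∷ y)  = trans (shift (dist x y) (wt (x ∩ y)))
  (trans (cong (2 +_) (dist-wt x y)) (cong suc (sym (+-suc _ _))))
  where
  shift : ∀ d c → d + 2 * suc c ≡ 2 + (d + 2 * c)
  shift = solve-∀
dist-wt (true ∷ x)  (false ∷ y) = cong suc (dist-wt x y)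
dist-wt (false ∷ x) (true ∷ y)  = trans (cong suc (dist-wt x y)) (sym (+-suc _ _))
dist-wt (false ∷ x) (false ∷ y) = dist-wt x y

dist-sym : (x y : Word n) → dist x y ≡ dist y x
dist-sym []          []          = refl
dist-sym (true ∷ x)  (true ∷ y)  = dist-sym x y
dist-sym (true ∷ x)  (false ∷ y) = cong suc (dist-sym x y)
dist-sym (false ∷ x) (true ∷ y)  = cong suc (dist-sym x y)
dist-sym (false ∷ x) (false ∷ y) = dist-sym x y

dist-refl : (x : Word n) → dist x x ≡ 0
dist-refl []          = refl
dist-refl (true ∷ x)  = dist-refl x
dist-refl (false ∷ x) = dist-refl x

dist-translate : (x y m : Word n) → dist (x ⊕ m) (y ⊕ m) ≡ dist x y
dist-translate []          []          []          = refl
dist-translate (true ∷ x)  (true ∷ y)  (true ∷ m)  = dist-translate x y m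
dist-translate (true ∷ x)  (true ∷ y)  (false ∷ m) = dist-translate x y m
dist-translate (true ∷ x)  (false ∷ y) (true ∷ m)  = cong suc (dist-translate x y m)
dist-translate (true ∷ x)  (false ∷ y) (false ∷ m) = cong suc (dist-translate x y m)
dist-translate (false ∷ x) (true ∷ y)  (true ∷ m)  = cong suc (dist-translate x y m)
dist-translate (false ∷ x) (true ∷ y)  (false ∷ m) = cong suc (dist-translate x y m)
dist-translate (false ∷ x) (false ∷ y) (true ∷ m)  = dist-translate x y m
dist-translate (false ∷ x) (false ∷ y) (false ∷ m) = dist-translate x y m

maj-rotate : (x y z : Word n) → maj x y z ≡ maj y z x
maj-rotate []       []       []       = refl
maj-rotate (a ∷ x) (b ∷ y) (c ∷ z) = cong₂ _∷_ (rotate a b c) (maj-rotate x y z)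
  where
  rotate : ∀ a b c → majority a b c ≡ majority b c a
  rotate true  true  true  = refl
  rotate true  true  false = refl
  rotate true  false true  = refl
  rotate true  false false = refl
  rotate false true  true  = refl
  rotate false true  false = refl
  rotate false false true  = refl
  rotate false false false = refl

-- Where `x` and `y` agree, the majority agrees with both; where they differ, it agrees with exactly
-- one of them. So it lies on a shortest path between them.
maj-between : (x y z : Word n) → dist x (maj x y z) + dist y (maj x y z) ≡ dist x y
maj-between []          []          []          = refl
maj-between (true ∷ x)  (true ∷ y)  (_ ∷ z)     = maj-between x y z
maj-between (true ∷ x)  (false ∷ y) (true ∷ z)  = trans (+-suc _ _) (cong suc (maj-between x y z))
maj-between (true ∷ x)  (false ∷ y) (false ∷ z) = cong suc (maj-between x y z)
maj-between (false ∷ x) (true ∷ y)  (true ∷ z)  = cong suc (maj-between x y z)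
maj-between (false ∷ x) (true ∷ y)  (false ∷ z) = trans (+-suc _ _) (cong suc (maj-between x y z))
maj-between (false ∷ x) (false ∷ y) (_ ∷ z)     = maj-between x y z

-- In each coordinate at most one of three words disagrees with their majority.
maj-disjoint : (x y z : Word n) → Disjoint (x ⊕ maj x y z) (y ⊕ maj x y z)
maj-disjoint []          []          []          = refl
maj-disjoint (true ∷ x)  (true ∷ y)  (_ ∷ z)     = maj-disjoint x y z
maj-disjoint (true ∷ x)  (false ∷ y) (true ∷ z)  = maj-disjoint x y z
maj-disjoint (true ∷ x)  (false ∷ y) (false ∷ z) = maj-disjoint x y z
maj-disjoint (false ∷ x) (true ∷ y)  (true ∷ z)  = maj-disjoint x y z
maj-disjoint (false ∷ x) (true ∷ y)  (false ∷ z) = maj-disjoint x y z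
maj-disjoint (false ∷ x) (false ∷ y) (_ ∷ z)     = maj-disjoint x y z

disjoint-sym : (x y : Word n) → Disjoint x y → Disjoint y x
disjoint-sym []          []          d = refl
disjoint-sym (true ∷ x)  (false ∷ y) d = disjoint-sym x y d
disjoint-sym (false ∷ x) (true ∷ y)  d = disjoint-sym x y d
disjoint-sym (false ∷ x) (false ∷ y) d = disjoint-sym x y d

∖-∩-disjoint : (w a b : Word n) → Disjoint a b → (w ∖ a) ∩ b ≡ w ∩ b
∖-∩-disjoint []          []          []          d = refl
∖-∩-disjoint (true ∷ w)  (true ∷ a)  (false ∷ b) d = cong (_ ∷_) (∖-∩-disjoint w a b d)
∖-∩-disjoint (true ∷ w)  (false ∷ a) (_ ∷ b)     d = cong (_ ∷_) (∖-∩-disjoint w a b d)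
∖-∩-disjoint (false ∷ w) (true ∷ a)  (false ∷ b) d = cong (_ ∷_) (∖-∩-disjoint w a b d)
∖-∩-disjoint (false ∷ w) (false ∷ a) (_ ∷ b)     d = cong (_ ∷_) (∖-∩-disjoint w a b d)

wt-∪ : (x y : Word n) → Disjoint x y → wt (x ∪ y) ≡ wt x + wt y
wt-∪ []          []          d = refl
wt-∪ (true ∷ x)  (false ∷ y) d = cong suc (wt-∪ x y d)
wt-∪ (false ∷ x) (true ∷ y)  d = trans (cong suc (wt-∪ x y d)) (sym (+-suc _ _))
wt-∪ (false ∷ x) (false ∷ y) d = wt-∪ x y d

disjoint-∪ : (w x y : Word n) → Disjoint x w → Disjoint y w → Disjoint (x ∪ y) w
disjoint-∪ []          []          []          d e = refl
disjoint-∪ (true ∷ w)  (false ∷ x) (false ∷ y) d e = disjoint-∪ w x y d e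
disjoint-∪ (false ∷ w) (true ∷ x)  (true ∷ y)  d e = disjoint-∪ w x y d e
disjoint-∪ (false ∷ w) (true ∷ x)  (false ∷ y) d e = disjoint-∪ w x y d e
disjoint-∪ (false ∷ w) (false ∷ x) (true ∷ y)  d e = disjoint-∪ w x y d e
disjoint-∪ (false ∷ w) (false ∷ x) (false ∷ y) d e = disjoint-∪ w x y d e

zeros : Word n
zeros = replicate _ false

wt-zeros : ∀ n → wt (zeros {n}) ≡ 0
wt-zeros zero    = refl
wt-zeros (suc n) = wt-zeros n

wt≡0⇒zeros : (x : Word n) → wt x ≡ 0 → x ≡ zeros
wt≡0⇒zeros []          p = refl
wt≡0⇒zeros (false ∷ x) p = cong (false ∷_) (wt≡0⇒zeros x p)

-- Points of words, and counting

_≟ʷ_ : (x y : Word n) → Dec (x ≡ y)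
_≟ʷ_ = Vec.≡-dec Bool._≟_

infix 4 _∋_

_∋_ : Word n → Fin n → Set
x ∋ i = lookup x i ≡ true

_∋?_ : (x : Word n) (i : Fin n) → Dec (x ∋ i)
x ∋? i = lookup x i Bool.≟ true

∋-∩⁺ : (x y : Word n) {i : Fin n} → x ∋ i → y ∋ i → x ∩ y ∋ i
∋-∩⁺ x y {i} p q = trans (lookup-zipWith _∧_ i x y) (cong₂ _∧_ p q)

∋-∩⁻ : (x y : Word n) {i : Fin n} → x ∩ y ∋ i → x ∋ i × y ∋ i
∋-∩⁻ x y {i} p with lookup x i | lookup y i | trans (sym (lookup-zipWith _∧_ i x y)) p
... | true | true | _ = refl , refl

wt≡0⇒∌ : (x : Word n) → wt x ≡ 0 → ∀ {i} → ¬ x ∋ i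
wt≡0⇒∌ (false ∷ x) p {suc i} q = wt≡0⇒∌ x p q

∌⇒wt≡0 : (x : Word n) → (∀ i → ¬ x ∋ i) → wt x ≡ 0
∌⇒wt≡0 []          p = refl
∌⇒wt≡0 (true ∷ x)  p = contradiction refl (p zero)
∌⇒wt≡0 (false ∷ x) p = ∌⇒wt≡0 x (λ i → p (suc i))

wt≤1⇒≡ : (x : Word n) → wt x ≤ 1 → ∀ {i j} → x ∋ i → x ∋ j → i ≡ j
wt≤1⇒≡ (_ ∷ x)     w {zero}  {zero}  p q = refl
wt≤1⇒≡ (true ∷ x)  w {zero}  {suc j} p q = contradiction q (wt≡0⇒∌ x (n≤0⇒n≡0 (≤-pred w)))
wt≤1⇒≡ (true ∷ x)  w {suc i} {_}     p q = contradiction p (wt≡0⇒∌ x (n≤0⇒n≡0 (≤-pred w)))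
wt≤1⇒≡ (false ∷ x) w {suc i} {suc j} p q = cong suc (wt≤1⇒≡ x w p q)

≡⇒wt≤1 : (x : Word n) → (∀ i j → x ∋ i → x ∋ j → i ≡ j) → wt x ≤ 1
≡⇒wt≤1 []          p = z≤n
≡⇒wt≤1 (true ∷ x)  p = s≤s (≤-reflexive (∌⇒wt≡0 x λ i q → contradiction (p zero (suc i) refl q) λ ()))
≡⇒wt≤1 (false ∷ x) p = ≡⇒wt≤1 x λ { i j q r → Fin.suc-injective (p (suc i) (suc j) q r) }

nonempty : (x : Word n) → wt x ≢ 0 → ∃[ i ] (x ∋ i)
nonempty []          p = contradiction refl p
nonempty (true ∷ x)  p = zero , refl
nonempty (false ∷ x) p = let i , q = nonempty x p in suc i , q

points : Word n → List (Fin n)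
points []          = []
points (true ∷ x)  = zero ∷ map suc (points x)
points (false ∷ x) = map suc (points x)

length-points : (x : Word n) → length (points x) ≡ wt x
length-points []          = refl
length-points (true ∷ x)  = cong suc (trans (length-map suc (points x)) (length-points x))
length-points (false ∷ x) = trans (length-map suc (points x)) (length-points x)

∈-points : (x : Word n) {i : Fin n} → x ∋ i → i ∈ points x
∈-points (true ∷ x)  {zero}  p = here refl
∈-points (true ∷ x)  {suc i} p = there (∈-map⁺ suc (∈-points x p))
∈-points (false ∷ x) {suc i} p = ∈-map⁺ suc (∈-points x p)

ins del : Word n → Fin n → Word n
ins x i = x [ i ]≔ true
del x i = x [ i ]≔ false

∋-ins-self : (x : Word n) (i : Fin n) → ins x i ∋ i
∋-ins-self x i = lookup∘update i x true

∋-ins⁺ : (x : Word n) (i : Fin n) {j : Fin n} → x ∋ j → ins x i ∋ j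
∋-ins⁺ x i {j} p with j Fin.≟ i
... | yes refl = ∋-ins-self x i
... | no j≢i   = trans (lookup∘update′ j≢i x true) p

∋-ins⁻ : (x : Word n) (i : Fin n) {j : Fin n} → ins x i ∋ j → j ≡ i ⊎ x ∋ j
∋-ins⁻ x i {j} p with j Fin.≟ i
... | yes j≡i = inj₁ j≡i
... | no j≢i  = inj₂ (trans (sym (lookup∘update′ j≢i x true)) p)

∋-del⁻ : (x : Word n) (i : Fin n) {j : Fin n} → del x i ∋ j → j ≢ i × x ∋ j
∋-del⁻ x i {j} p with j Fin.≟ i
... | yes refl = contradiction (trans (sym p) (lookup∘update i x false)) λ ()
... | no j≢i  = j≢i , trans (sym (lookup∘update′ j≢i x false)) p

wt-ins : (x : Word n) (i : Fin n) → ¬ x ∋ i → wt (ins x i) ≡ suc (wt x)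
wt-ins (true ∷ x)  zero    p = contradiction refl p
wt-ins (false ∷ x) zero    p = refl
wt-ins (true ∷ x)  (suc i) p = cong suc (wt-ins x i p)
wt-ins (false ∷ x) (suc i) p = wt-ins x i p

wt-del : (x : Word n) (i : Fin n) → x ∋ i → suc (wt (del x i)) ≡ wt x
wt-del (true ∷ x)  zero    p = refl
wt-del (true ∷ x)  (suc i) p = cong suc (wt-del x i p)
wt-del (false ∷ x) (suc i) p = wt-del x i p

length-filter-split : ∀ {P : A → Set} (P? : ∀ x → Dec (P x)) (L : List A) →
  length L ≡ length (filter P? L) + length (filter (λ x → ¬? (P? x)) L)
length-filter-split P? []      = refl
length-filter-split P? (x ∷ L) with P? x
... | yes _ = cong suc (length-filter-split P? L)
... | no  _ = trans (cong suc (length-filter-split P? L)) (sym (+-suc _ _))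

private
  disjoint-family+ : ∀ {k} (V : Word n) (L : List (Word n)) → AllPairs Disjoint L →
    All (λ x → wt x ≡ k) L → All (Disjoint V) L → length L * k + wt V ≤ n
  disjoint-family+ V []      _        _         _        = wt≤n V
  disjoint-family+ {k = k} V (x ∷ L) (d ∷ ds) (w ∷ ws) (e ∷ es) = begin
    k + length L * k + wt V   ≡⟨ rearrange k (length L * k) (wt V) ⟩
    length L * k + (wt V + k) ≡⟨ cong (length L * k +_) (trans (cong (wt V +_) (sym w)) (sym (wt-∪ V x e))) ⟩
    length L * k + wt (V ∪ x) ≤⟨ disjoint-family+ (V ∪ x) L ds ws
                                   (All.zipWith (λ { {y} (p , q) → disjoint-∪ y V x p q }) (es , d)) ⟩
    _                         ∎
    where
    open ≤-Reasoning
    rearrange : ∀ k l v → k + l + v ≡ l + (v + k)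
    rearrange = solve-∀

disjoint-family : ∀ {k} (L : List (Word n)) → AllPairs Disjoint L →
  All (λ x → wt x ≡ k) L → length L * k ≤ n
disjoint-family {n} {k} L ds ws = m+n≤o⇒m≤o (length L * k)
  (disjoint-family+ zeros L ds ws (All.tabulate λ {x} _ → zeros-disjoint x))
  where
  zeros-disjoint : ∀ {n} (x : Word n) → Disjoint zeros x
  zeros-disjoint []      = refl
  zeros-disjoint (_ ∷ x) = zeros-disjoint x

-- Each word is charged to the first `t` that covers it; the classes are sublists, so the pairwise
-- condition `S` and the pointwise condition `Q` pass to them. The factor `k` stays on the left so
-- that bounds such as n/k need no division.
cover-bound : ∀ {S : A → A → Set} {Q : A → Set} {R : B → A → Set} (R? : ∀ t x → Dec (R t x)) {k c : ℕ} →
  (∀ t L → AllPairs S L → All Q L → All (R t) L → length L * k ≤ c) →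
  ∀ T L → AllPairs S L → All Q L → All (λ x → Any (λ t → R t x) T) L → length L * k ≤ length T * c
cover-bound R? fibre [] []      s q a = z≤n
cover-bound R? fibre [] (x ∷ L) s q (() ∷ _)
cover-bound {A = A} {R = R} R? {k} {c} fibre (t ∷ T) L s q a = begin
  length L * k                     ≡⟨ cong (_* k) (length-filter-split (R? t) L) ⟩
  (length L₁ + length L₂) * k      ≡⟨ *-distribʳ-+ k (length L₁) (length L₂) ⟩
  length L₁ * k + length L₂ * k    ≤⟨ +-mono-≤
     (fibre t L₁ (AllPairs.filter⁺ (R? t) s) (All.filter⁺ (R? t) q) (All.all-filter (R? t) L))
     (cover-bound R? fibre T L₂ (AllPairs.filter⁺ ¬R? s) (All.filter⁺ ¬R? q)
       (All.zipWith later (All.all-filter ¬R? L , All.filter⁺ ¬R? a))) ⟩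
  c + length T * c                 ∎
  where
  open ≤-Reasoning
  ¬R? = λ x → ¬? (R? t x)
  L₁ = filter (R? t) L
  L₂ = filter ¬R? L
  later : ∀ {x} → ¬ R t x × Any (λ u → R u x) (t ∷ T) → Any (λ u → R u x) T
  later (¬r , here r)  = contradiction r ¬r
  later (¬r , there r) = r

subwords : Word n → List (Word n)
subwords []          = [] ∷ []
subwords (true ∷ a)  = map (true ∷_) (subwords a) ++ map (false ∷_) (subwords a)
subwords (false ∷ a) = map (false ∷_) (subwords a)

∈-subwords : (x a : Word n) → x ∩ a ∈ subwords a
∈-subwords []          []          = here refl
∈-subwords (true ∷ x)  (true ∷ a)  = ∈-++⁺ˡ (∈-map⁺ (true ∷_) (∈-subwords x a))
∈-subwords (false ∷ x) (true ∷ a)  = ∈-++⁺ʳ (map (true ∷_) (subwords a)) (∈-map⁺ (false ∷_) (∈-subwords x a))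
∈-subwords (true ∷ x)  (false ∷ a) = ∈-map⁺ (false ∷_) (∈-subwords x a)
∈-subwords (false ∷ x) (false ∷ a) = ∈-map⁺ (false ∷_) (∈-subwords x a)

length-subwords : (a : Word n) → length (subwords a) ≡ 2 ^ wt a
length-subwords []          = refl
length-subwords (true ∷ a)  = trans (length-++ (map (true ∷_) (subwords a)))
  (cong₂ _+_ (trans (length-map (true ∷_) (subwords a)) (length-subwords a))
    (trans (length-map (false ∷_) (subwords a)) (trans (length-subwords a) (sym (+-identityʳ _)))))
length-subwords (false ∷ a) = trans (length-map (false ∷_) (subwords a)) (length-subwords a)

singletons : Word n → List (Word n)
singletons []          = []
singletons (true ∷ a)  = (true ∷ zeros) ∷ map (false ∷_) (singletons a)
singletons (false ∷ a) = map (false ∷_) (singletons a)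

∈-singletons : (x a : Word n) → wt (x ∩ a) ≡ 1 → x ∩ a ∈ singletons a
∈-singletons []          []          ()
∈-singletons (true ∷ x)  (true ∷ a)  p = here (cong (true ∷_) (wt≡0⇒zeros (x ∩ a) (suc-injective p)))
∈-singletons (false ∷ x) (true ∷ a)  p = there (∈-map⁺ (false ∷_) (∈-singletons x a p))
∈-singletons (true ∷ x)  (false ∷ a) p = ∈-map⁺ (false ∷_) (∈-singletons x a p)
∈-singletons (false ∷ x) (false ∷ a) p = ∈-map⁺ (false ∷_) (∈-singletons x a p)

length-singletons : (a : Word n) → length (singletons a) ≡ wt a
length-singletons []          = refl
length-singletons (true ∷ a)  = cong suc (trans (length-map (false ∷_) (singletons a)) (length-singletons a))
length-singletons (false ∷ a) = trans (length-map (false ∷_) (singletons a)) (length-singletons a)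

length-cartesianProduct : (xs : List A) (ys : List B) → length (cartesianProduct xs ys) ≡ length xs * length ys
length-cartesianProduct []       ys = refl
length-cartesianProduct (x ∷ xs) ys = trans (length-++ (map (x ,_) ys))
  (cong₂ _+_ (length-map (x ,_) ys) (length-cartesianProduct xs ys))

-- Deleting the common point `i` leaves pairwise disjoint words of weight `k`.
star-bound : ∀ {k} (i : Fin n) (L : List (Word n)) → AllPairs (λ x y → wt (x ∩ y) ≤ 1) L →
  All (λ x → wt x ≡ suc k) L → All (_∋ i) L → length L * k ≤ n
star-bound {n} {k} i L s w c = subst (λ l → l * k ≤ n) (length-map (λ x → del x i) L)
  (disjoint-family (map (λ x → del x i) L) (AllPairs.map⁺ (pairs L s c))
    (All.map⁺ (All.zipWith (λ { {x} (p , q) → suc-injective (trans (wt-del x i q) p) }) (w , c))))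
  where
  pairs : ∀ L → AllPairs (λ x y → wt (x ∩ y) ≤ 1) L → All (_∋ i) L →
    AllPairs (λ x y → Disjoint (del x i) (del y i)) L
  pairs []      []      []      = []
  pairs (x ∷ L) (p ∷ s) (q ∷ c) = All.zipWith meet (p , c) ∷ pairs L s c
    where
    meet : ∀ {y} → wt (x ∩ y) ≤ 1 × y ∋ i → Disjoint (del x i) (del y i)
    meet {y} (p , r) = ∌⇒wt≡0 (del x i ∩ del y i) λ j t →
      let u , v = ∋-∩⁻ (del x i) (del y i) t
          j≢i , u′ = ∋-del⁻ x i u
      in j≢i (wt≤1⇒≡ (x ∩ y) p (∋-∩⁺ x y u′ (proj₂ (∋-del⁻ y i v))) (∋-∩⁺ x y q r))

-- Majority centres and traces on three blocks

private
  halve : ∀ {p q r} k → p + q ≡ k + k → q + r ≡ k + k → r + p ≡ k + k → p ≡ k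
  halve {p} {q} {r} k pq qr rp = *-cancelˡ-≡ p k 2 (+-cancelʳ-≡ (k + k) (2 * p) (2 * k) (begin
    2 * p + (k + k)     ≡⟨ cong (2 * p +_) (sym qr) ⟩
    2 * p + (q + r)     ≡⟨ regroup p q r ⟩
    (p + q) + (r + p)   ≡⟨ cong₂ _+_ pq rp ⟩
    (k + k) + (k + k)   ≡⟨ double k ⟩
    2 * k + (k + k)     ∎))
    where
    open ≡-Reasoning
    regroup : ∀ p q r → 2 * p + (q + r) ≡ (p + q) + (r + p)
    regroup = solve-∀
    double : ∀ k → (k + k) + (k + k) ≡ 2 * k + (k + k)
    double = solve-∀

record Centre (k : ℕ) (x y z : Word n) : Set where
  field
    centre : Word n
    wt₁ : wt (x ⊕ centre) ≡ k
    wt₂ : wt (y ⊕ centre) ≡ k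
    wt₃ : wt (z ⊕ centre) ≡ k
    dis₁₂ : Disjoint (x ⊕ centre) (y ⊕ centre)
    dis₁₃ : Disjoint (x ⊕ centre) (z ⊕ centre)
    dis₂₃ : Disjoint (y ⊕ centre) (z ⊕ centre)

-- The three distances to the majority add up pairwise to `k + k`, which forces each of them to be
-- `k`; `maj-rotate` transfers the facts about one pair to the other two.
centre-of-triple : ∀ k (x y z : Word n) → dist x y ≡ k + k → dist y z ≡ k + k → dist x z ≡ k + k → Centre k x y z
centre-of-triple k x y z xy yz xz = record
  { centre = m
  ; wt₁ = halve k x+y y+z z+x
  ; wt₂ = halve k y+z z+x x+y
  ; wt₃ = halve k z+x x+y y+z
  ; dis₁₂ = maj-disjoint x y z
  ; dis₁₃ = disjoint-sym (z ⊕ m) (x ⊕ m)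
      (subst (λ m → Disjoint (z ⊕ m) (x ⊕ m)) (maj-rotate z x y) (maj-disjoint z x y))
  ; dis₂₃ = subst (λ m → Disjoint (y ⊕ m) (z ⊕ m)) (sym (maj-rotate x y z)) (maj-disjoint y z x)
  }
  where
  m = maj x y z
  x+y : dist x m + dist y m ≡ k + k
  x+y = trans (maj-between x y z) xy
  y+z : dist y m + dist z m ≡ k + k
  y+z = trans (subst (λ m → dist y m + dist z m ≡ dist y z) (sym (maj-rotate x y z)) (maj-between y z x)) yz
  z+x : dist z m + dist x m ≡ k + k
  z+x = trans (subst (λ m → dist z m + dist x m ≡ dist z x) (maj-rotate z x y) (maj-between z x y))
    (trans (dist-sym z x) xz)

module ThreeBlocks (a b c : Word n) (a⊥b : Disjoint a b) (a⊥c : Disjoint a c) (b⊥c : Disjoint b c) where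

  Trace : Set
  Trace = Word n × Word n × Word n

  trace : Word n → Trace
  trace w = w ∩ a , w ∩ b , w ∩ c

  outer : Word n → Word n
  outer w = w ∖ a ∖ b ∖ c

  private
    b-part : ∀ w → (w ∖ a) ∩ b ≡ w ∩ b
    b-part w = ∖-∩-disjoint w a b a⊥b

    c-part : ∀ w → (w ∖ a ∖ b) ∩ c ≡ w ∩ c
    c-part w = trans (∖-∩-disjoint (w ∖ a) b c b⊥c) (∖-∩-disjoint w a c a⊥c)

  wt-parts : ∀ w → wt w ≡ wt (w ∩ a) + (wt (w ∩ b) + (wt (w ∩ c) + wt (outer w)))
  wt-parts w = trans (wt-split w a) (cong (wt (w ∩ a) +_)
    (trans (wt-split (w ∖ a) b) (cong₂ _+_ (cong wt (b-part w))
      (trans (wt-split (w ∖ a ∖ b) c) (cong (_+ wt (outer w)) (cong wt (c-part w)))))))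

  dist-outer : ∀ v w → trace v ≡ trace w → dist v w ≡ dist (outer v) (outer w)
  dist-outer v w eq = trans (step v w a eqa)
    (trans (step (v ∖ a) (w ∖ a) b (trans (b-part v) (trans eqb (sym (b-part w)))))
      (step (v ∖ a ∖ b) (w ∖ a ∖ b) c (trans (c-part v) (trans eqc (sym (c-part w))))))
    where
    eqa = proj₁ (,-injective eq)
    eqb = proj₁ (,-injective (proj₂ (,-injective eq)))
    eqc = proj₂ (,-injective (proj₂ (,-injective eq)))
    step : ∀ v w a → v ∩ a ≡ w ∩ a → dist v w ≡ dist (v ∖ a) (w ∖ a)
    step v w a e = trans (dist-split v w a)
      (cong (_+ dist (v ∖ a) (w ∖ a)) (trans (cong (λ t → dist t (w ∩ a)) e) (dist-refl (w ∩ a))))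

  -- For a block of weight `k`, the hypothesis says that `w` is within distance 2k of it. Adding the
  -- hypotheses for two blocks cancels the traces on them, and what remains is twice the outer part
  -- plus twice the trace on the third block, at most 2k.
  outer-bounds : ∀ k w → wt w ≤ k + 2 * wt (w ∩ a) → wt w ≤ k + 2 * wt (w ∩ b) → wt w ≤ k + 2 * wt (w ∩ c) →
    wt (outer w) + wt (w ∩ a) ≤ k × wt (outer w) + wt (w ∩ b) ≤ k × wt (outer w) + wt (w ∩ c) ≤ k
  outer-bounds k w p q r = pair s t u o (via e₁ q) (via e₁ r)
                         , pair t u s o (via e₂ r) (via e₂ p)
                         , pair u s t o (via e₃ p) (via e₃ q)
    where
    s = wt (w ∩ a)
    t = wt (w ∩ b)
    u = wt (w ∩ c)
    o = wt (outer w)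
    via : ∀ {x y z} → x ≡ y → x ≤ z → y ≤ z
    via refl l = l
    sum₁ : ∀ s t u o → s + (t + (u + o)) ≡ t + u + (o + s)
    sum₁ = solve-∀
    sum₂ : ∀ s t u o → s + (t + (u + o)) ≡ u + s + (o + t)
    sum₂ = solve-∀
    sum₃ : ∀ s t u o → s + (t + (u + o)) ≡ s + t + (o + u)
    sum₃ = solve-∀
    e₁ = trans (wt-parts w) (sum₁ s t u o)
    e₂ = trans (wt-parts w) (sum₂ s t u o)
    e₃ = trans (wt-parts w) (sum₃ s t u o)
    pair : ∀ s t u o → t + u + (o + s) ≤ k + 2 * t → t + u + (o + s) ≤ k + 2 * u → o + s ≤ k
    pair s t u o p q = *-cancelˡ-≤ 2 (+-cancelˡ-≤ (2 * (t + u)) _ _ (begin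
      2 * (t + u) + 2 * (o + s)               ≡⟨ lhs s t u o ⟩
      t + u + (o + s) + (t + u + (o + s))     ≤⟨ +-mono-≤ p q ⟩
      k + 2 * t + (k + 2 * u)                 ≡⟨ rhs t u k ⟩
      2 * (t + u) + 2 * k                     ∎))
      where
      open ≤-Reasoning
      lhs : ∀ s t u o → 2 * (t + u) + 2 * (o + s) ≡ t + u + (o + s) + (t + u + (o + s))
      lhs = solve-∀
      rhs : ∀ t u k → k + 2 * t + (k + 2 * u) ≡ 2 * (t + u) + 2 * k
      rhs = solve-∀

  traces : List Trace
  traces = cartesianProduct (subwords a) (cartesianProduct (subwords b) (subwords c))

  trace∈traces : ∀ w → trace w ∈ traces
  trace∈traces w = ∈-cartesianProduct⁺ (∈-subwords w a) (∈-cartesianProduct⁺ (∈-subwords w b) (∈-subwords w c))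

  -- Two words with the same trace differ only outside the blocks, where a word
  -- has at most h points; so distance 2h forces both outer parts to have h points and to be disjoint.
  family-bound : ∀ h (T : List Trace) (L : List (Word n)) → AllPairs (λ v w → h + h ≤ dist v w) L →
    All (λ w → wt (outer w) < h ⊎ wt (outer w) ≡ h × trace w ∈ T) L →
    length L * h ≤ length T * n + length traces * h
  family-bound h T L s q = begin
    length L * h                    ≡⟨ cong (_* h) (length-filter-split h? L) ⟩
    (length L₁ + length L₂) * h     ≡⟨ *-distribʳ-+ h (length L₁) (length L₂) ⟩
    length L₁ * h + length L₂ * h   ≤⟨ +-mono-≤ bound₁ bound₂ ⟩
    length T * n + length traces * h ∎
    where
    open ≤-Reasoning
    h? = λ w → wt (outer w) ≟ h
    L₁ = filter h? L
    L₂ = filter (λ w → ¬? (h? w)) L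
    _≟ᵗ_ : (s t : Trace) → Dec (s ≡ t)
    _≟ᵗ_ = ≡-dec _≟ʷ_ (≡-dec _≟ʷ_ _≟ʷ_)
    R? : ∀ t w → Dec (t ≡ trace w)
    R? t w = t ≟ᵗ trace w

    apart : ∀ v w → trace v ≡ trace w → h + h ≤ dist v w →
      h + h + 2 * wt (outer v ∩ outer w) ≤ wt (outer v) + wt (outer w)
    apart v w eq d = ≤-trans (+-monoˡ-≤ _ (≤-trans d (≤-reflexive (dist-outer v w eq))))
      (≤-reflexive (dist-wt (outer v) (outer w)))

    bound₁ : length L₁ * h ≤ length T * n
    bound₁ = cover-bound R? fibre T L₁ (AllPairs.filter⁺ h? s) (All.all-filter h? L)
      (All.zipWith inT (All.all-filter h? L , All.filter⁺ h? q))
      where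
      inT : ∀ {w} → wt (outer w) ≡ h × (wt (outer w) < h ⊎ wt (outer w) ≡ h × trace w ∈ T) →
        Any (λ t → t ≡ trace w) T
      inT (e , inj₁ l) = contradiction e (<⇒≢ l)
      inT (e , inj₂ (_ , m)) = Any.map sym m
      fibre : ∀ t L → AllPairs (λ v w → h + h ≤ dist v w) L → All (λ w → wt (outer w) ≡ h) L →
        All (λ w → t ≡ trace w) L → length L * h ≤ n
      fibre t L s q r = subst (λ l → l * h ≤ n) (length-map outer L)
        (disjoint-family (map outer L) (AllPairs.map⁺ (pairs L s q r)) (All.map⁺ q))
        where
        pairs : ∀ L → AllPairs (λ v w → h + h ≤ dist v w) L → All (λ w → wt (outer w) ≡ h) L →
          All (λ w → t ≡ trace w) L → AllPairs (λ v w → Disjoint (outer v) (outer w)) L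
        pairs []      []      []      []      = []
        pairs (v ∷ L) (d ∷ s) (e ∷ q) (f ∷ r) = All.zipWith disj (d , All.zip (q , r)) ∷ pairs L s q r
          where
          disj : ∀ {w} → h + h ≤ dist v w × wt (outer w) ≡ h × t ≡ trace w → Disjoint (outer v) (outer w)
          disj {w} (d , e′ , f′) = *-cancelˡ-≡ _ 0 2 (n≤0⇒n≡0 (+-cancelˡ-≤ (h + h) _ _
            (≤-trans (apart v w (trans (sym f) f′) d)
              (≤-reflexive (trans (cong₂ _+_ e e′) (sym (+-identityʳ (h + h))))))))

    bound₂ : length L₂ * h ≤ length traces * h
    bound₂ = *-monoˡ-≤ h (subst₂ _≤_ (*-identityʳ (length L₂)) (*-identityʳ (length traces))
      (cover-bound R? fibre traces L₂ (AllPairs.filter⁺ _ s)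
        (All.zipWith small (All.all-filter (λ w → ¬? (h? w)) L , All.filter⁺ (λ w → ¬? (h? w)) q))
        (All.tabulate λ {w} _ → Any.map sym (trace∈traces w))))
      where
      small : ∀ {w} → wt (outer w) ≢ h × (wt (outer w) < h ⊎ wt (outer w) ≡ h × trace w ∈ T) → wt (outer w) < h
      small (_ , inj₁ l) = l
      small (e , inj₂ (e′ , _)) = contradiction e′ e
      fibre : ∀ t L → AllPairs (λ v w → h + h ≤ dist v w) L → All (λ w → wt (outer w) < h) L →
        All (λ w → t ≡ trace w) L → length L * 1 ≤ 1
      fibre t []          _ _ _ = z≤n
      fibre t (v ∷ [])    _ _ _ = s≤s z≤n
      fibre t (v ∷ w ∷ L) ((d ∷ _) ∷ _) (e ∷ e′ ∷ _) (f ∷ f′ ∷ _) = contradiction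
        (<-≤-trans (+-mono-< e e′) (≤-trans (m≤m+n (h + h) _) (apart v w (trans (sym f) f′) d))) (<-irrefl refl)

-- Three words at mutual distance 2h + 2

TwoDist : ℕ → Word n → Word n → Set
TwoDist h x y = dist x y ≡ h + h ⊎ dist x y ≡ h + h + 2

2h+2≡ : ∀ h → h + h + 2 ≡ suc h + suc h
2h+2≡ = solve-∀

TwoDist⇒≥ : ∀ h (x y : Word n) → TwoDist h x y → h + h ≤ dist x y
TwoDist⇒≥ h x y (inj₁ e) = ≤-reflexive (sym e)
TwoDist⇒≥ h x y (inj₂ e) = ≤-trans (m≤m+n (h + h) 2) (≤-reflexive (sym e))

TwoDist⇒≤ : ∀ h (x y : Word n) → TwoDist h x y → dist x y ≤ suc h + suc h
TwoDist⇒≤ h x y (inj₁ e) = ≤-trans (≤-reflexive e) (≤-trans (m≤m+n (h + h) 2) (≤-reflexive (2h+2≡ h)))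
TwoDist⇒≤ h x y (inj₂ e) = ≤-reflexive (trans e (2h+2≡ h))

cube : ℕ → ℕ
cube k = k * (k * k)

wt-bound : ∀ k (w a : Word n) → wt a ≡ k → dist w a ≤ k + k → wt w ≤ k + 2 * wt (w ∩ a)
wt-bound k w a wa d = +-cancelʳ-≤ k _ _ (begin
  wt w + k                        ≡⟨ cong (wt w +_) (sym wa) ⟩
  wt w + wt a                     ≡⟨ sym (dist-wt w a) ⟩
  dist w a + 2 * wt (w ∩ a)       ≤⟨ +-monoˡ-≤ _ d ⟩
  k + k + 2 * wt (w ∩ a)          ≡⟨ swap k (2 * wt (w ∩ a)) ⟩
  k + 2 * wt (w ∩ a) + k          ∎)
  where
  open ≤-Reasoning
  swap : ∀ k t → k + k + t ≡ k + t + k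
  swap = solve-∀

-- Around the centre the blocks have weight `h`, so the outer part and any one trace together have
-- at most `h` points. An outer part of `h` points thus forces all traces to be empty: only one
-- trace contributes to the coefficient of `n`.
equidistant-bound : (x y z : Word n) → dist x y ≡ h + h → dist y z ≡ h + h → dist x z ≡ h + h →
  (L : List (Word n)) → AllPairs (TwoDist h) L →
  All (λ w → dist x w ≡ h + h) L → All (λ w → dist y w ≡ h + h) L → All (λ w → dist z w ≡ h + h) L →
  length L * h ≤ n + cube (2 ^ h) * h
equidistant-bound {n} {h} x y z xy yz xz L d dx dy dz = begin
  length L * h                                     ≡⟨ cong (_* h) (sym (length-map (_⊕ m) L)) ⟩
  length (map (_⊕ m) L) * h                        ≤⟨ family-bound h T (map (_⊕ m) L) (AllPairs.map⁺ (AllPairs.map (λ {v} {w} → far v w) d))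
                                                      (All.map⁺ (All.zipWith classify (dx , All.zip (dy , dz)))) ⟩
  1 * n + length traces * h                        ≡⟨ cong₂ _+_ (*-identityˡ n) (cong (_* h) length-traces) ⟩
  n + cube (2 ^ h) * h                             ∎
  where
  open ≤-Reasoning
  open Centre (centre-of-triple h x y z xy yz xz) renaming (centre to m)
  open ThreeBlocks (x ⊕ m) (y ⊕ m) (z ⊕ m) dis₁₂ dis₁₃ dis₂₃
  T = (zeros , zeros , zeros) ∷ []
  length-traces : length traces ≡ cube (2 ^ h)
  length-traces = trans (length-cartesianProduct (subwords (x ⊕ m)) _) (cong₂ _*_
    (trans (length-subwords (x ⊕ m)) (cong (2 ^_) wt₁))
    (trans (length-cartesianProduct (subwords (y ⊕ m)) _) (cong₂ _*_
      (trans (length-subwords (y ⊕ m)) (cong (2 ^_) wt₂))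
      (trans (length-subwords (z ⊕ m)) (cong (2 ^_) wt₃)))))
  far : ∀ v w → TwoDist h v w → h + h ≤ dist (v ⊕ m) (w ⊕ m)
  far v w e = ≤-trans (TwoDist⇒≥ h v w e) (≤-reflexive (sym (dist-translate v w m)))
  near : ∀ v {w} → wt (v ⊕ m) ≡ h → dist v w ≡ h + h → wt (w ⊕ m) ≤ h + 2 * wt ((w ⊕ m) ∩ (v ⊕ m))
  near v {w} wv e = wt-bound h (w ⊕ m) (v ⊕ m) wv (≤-reflexive (trans (dist-translate w v m) (trans (dist-sym w v) e)))
  classify : ∀ {w} → dist x w ≡ h + h × dist y w ≡ h + h × dist z w ≡ h + h →
    wt (outer (w ⊕ m)) < h ⊎ wt (outer (w ⊕ m)) ≡ h × trace (w ⊕ m) ∈ T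
  classify {w} (ex , ey , ez) = split (m≤n⇒m<n∨m≡n (m+n≤o⇒m≤o _ bx))
    where
    bounds = outer-bounds h (w ⊕ m) (near x wt₁ ex) (near y wt₂ ey) (near z wt₃ ez)
    bx = proj₁ bounds
    empty : ∀ v → wt (outer (w ⊕ m)) ≡ h → wt (outer (w ⊕ m)) + wt ((w ⊕ m) ∩ (v ⊕ m)) ≤ h →
      (w ⊕ m) ∩ (v ⊕ m) ≡ zeros
    empty v e b = wt≡0⇒zeros _ (n≤0⇒n≡0 (+-cancelˡ-≤ h _ 0 (≤-trans
      (subst (λ o → o + wt ((w ⊕ m) ∩ (v ⊕ m)) ≤ h) e b) (≤-reflexive (sym (+-identityʳ h))))))
    split : wt (outer (w ⊕ m)) < h ⊎ wt (outer (w ⊕ m)) ≡ h →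
      wt (outer (w ⊕ m)) < h ⊎ wt (outer (w ⊕ m)) ≡ h × trace (w ⊕ m) ∈ T
    split (inj₁ l) = inj₁ l
    split (inj₂ e) = inj₂ (e , here (cong₂ _,_ (empty x e bx)
      (cong₂ _,_ (empty y e (proj₁ (proj₂ bounds))) (empty z e (proj₂ (proj₂ bounds))))))

FarTriple : ℕ → List (Word n) → Set
FarTriple h C = ∃[ x ] ∃[ y ] ∃[ z ] (x ∈ C × y ∈ C × z ∈ C ×
  dist x y ≡ suc h + suc h × dist y z ≡ suc h + suc h × dist x z ≡ suc h + suc h)

FarTriple-mono : {L M : List (Word n)} → L ⊆ M → FarTriple h L → FarTriple h M
FarTriple-mono s (x , y , z , x∈ , y∈ , z∈ , e) = x , y , z , s x∈ , s y∈ , s z∈ , e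

far? : ∀ h (x w : Word n) → Dec (dist x w ≡ suc h + suc h)
far? h x w = dist x w ≟ suc h + suc h

near-if-not-far : ∀ h (x y : Word n) → dist x y ≢ suc h + suc h × TwoDist h x y → dist x y ≡ h + h
near-if-not-far h x y (f , inj₁ e) = e
near-if-not-far h x y (f , inj₂ e) = contradiction (trans e (2h+2≡ h)) f

far-pair-or-equidistant : (L : List (Word n)) → AllPairs (TwoDist h) L →
  (∃[ y ] ∃[ z ] (y ∈ L × z ∈ L × dist y z ≡ suc h + suc h)) ⊎ AllPairs (λ y z → dist y z ≡ h + h) L
far-pair-or-equidistant []      []      = inj₂ []
far-pair-or-equidistant {h = h} (x ∷ L) (d ∷ ds) with Any.any? (far? h x) L
... | yes p = let z , z∈ , e = find p in inj₁ (x , z , here refl , there z∈ , e)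
... | no ¬p with far-pair-or-equidistant L ds
...   | inj₁ (y , z , y∈ , z∈ , e) = inj₁ (y , z , there y∈ , there z∈ , e)
...   | inj₂ es = inj₂ (All.zipWith (λ {w} → near-if-not-far h x w) (All.¬Any⇒All¬ L ¬p , d) ∷ es)

-- The summand `3 * h` pays for the first three words, around whose centre the others are counted;
-- it also covers the lists that are too short for this.
equidistant-code-bound : ∀ (L : List (Word n)) → AllPairs (λ y z → dist y z ≡ h + h) L →
  length L * h ≤ 3 * h + (n + cube (2 ^ h) * h)
equidistant-code-bound []      _ = z≤n
equidistant-code-bound {h = h} (_ ∷ []) _ = ≤-trans (*-monoˡ-≤ h {1} {3} (s≤s z≤n)) (m≤m+n (3 * h) _)
equidistant-code-bound {h = h} (_ ∷ _ ∷ []) _ = ≤-trans (*-monoˡ-≤ h {2} {3} (s≤s (s≤s z≤n))) (m≤m+n (3 * h) _)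
equidistant-code-bound {h = h} (x ∷ y ∷ z ∷ L) ((xy ∷ xz ∷ xL) ∷ (yz ∷ yL) ∷ zL ∷ d) =
  ≤-trans (≤-reflexive (*-distribʳ-+ h 3 (length L)))
    (+-monoʳ-≤ (3 * h) (equidistant-bound x y z xy yz xz L (AllPairs.map inj₁ d) xL yL zL))

-- Two words at distance 2h+2 from `x` and from each other would complete a far triple. Otherwise
-- the words at distance 2h+2 from `x` are mutually at distance 2h, hence few, and may be discarded.
peel : (x : Word n) (L : List (Word n)) → AllPairs (TwoDist h) (x ∷ L) → FarTriple h (x ∷ L) ⊎
  ∃[ R ] (R ⊆ L × AllPairs (TwoDist h) R × All (λ w → dist x w ≡ h + h) R ×
          length L * h ≤ 3 * h + (n + cube (2 ^ h) * h) + length R * h)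
peel {n} {h} x L (dx ∷ d) with far-pair-or-equidistant (filter (far? h x) L) (AllPairs.filter⁺ (far? h x) d)
... | inj₁ (y , z , y∈ , z∈ , e) =
  let y∈L , ey = ∈-filter⁻ (far? h x) y∈
      z∈L , ez = ∈-filter⁻ (far? h x) z∈
  in inj₁ (x , y , z , here refl , there y∈L , there z∈L , ey , e , ez)
... | inj₂ es = inj₂ (R , (λ m → proj₁ (∈-filter⁻ ¬far? m)) , AllPairs.filter⁺ ¬far? d
    , All.zipWith (λ {w} → near-if-not-far h x w) (All.all-filter ¬far? L , All.filter⁺ ¬far? dx)
    , ≤-trans (≤-reflexive (trans (cong (_* h) (length-filter-split (far? h x) L))
          (*-distribʳ-+ h (length (filter (far? h x) L)) (length R))))
        (+-monoˡ-≤ (length R * h) (equidistant-code-bound _ es)))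
  where
  ¬far? = λ w → ¬? (far? h x w)
  R = filter ¬far? L

-- Three rounds of peeling produce `x`, `y`, `z` at mutual distance 2h, and all words that survive
-- are at distance 2h from each of them. The rounds cost `3 * δ`, the words `y` and `z` cost
-- `2 * h`, and the survivors cost `e`; running out of words earlier only costs less.
far-triple-or-small : (C : List (Word n)) → AllPairs (TwoDist h) C →
  FarTriple h C ⊎ length C * h ≤ 12 * h + 4 * (n + cube (2 ^ h) * h)
far-triple-or-small [] _ = inj₂ z≤n
far-triple-or-small {n} {h} (x ∷ L) d with peel x L d
... | inj₁ t = inj₁ t
... | inj₂ (R , R⊆ , dR , xR , b) = second R R⊆ dR xR b
  where
  e δ : ℕ
  e = n + cube (2 ^ h) * h
  δ = 3 * h + e
  Goal = FarTriple h (x ∷ L) ⊎ length (x ∷ L) * h ≤ 12 * h + 4 * e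
  finish : length L * h ≤ 3 * δ + e + 2 * h → Goal
  finish l = inj₂ (≤-trans (+-monoʳ-≤ h l) (≤-reflexive (total h e)))
    where
    total : ∀ h e → h + (3 * (3 * h + e) + e + 2 * h) ≡ 12 * h + 4 * e
    total = solve-∀
  second : ∀ R → R ⊆ L → AllPairs (TwoDist h) R → All (λ w → dist x w ≡ h + h) R → length L * h ≤ δ + length R * h → Goal
  second [] _ _ _ b = finish (≤-trans b (≤-trans (m≤m+n _ (2 * δ + e + 2 * h)) (≤-reflexive (sum δ e h))))
    where
    sum : ∀ δ e h → δ + 0 + (2 * δ + e + 2 * h) ≡ 3 * δ + e + 2 * h
    sum = solve-∀
  second (y ∷ R) R⊆ dR (xy ∷ xR) b with peel y R dR
  ... | inj₁ t = inj₁ (FarTriple-mono (λ m → there (R⊆ m)) t)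
  ... | inj₂ (S , S⊆ , dS , yS , c) = third S (λ m → R⊆ (there (S⊆ m))) dS (All.anti-mono S⊆ xR) yS
      (≤-trans b (+-monoʳ-≤ δ (+-monoʳ-≤ h c)))
    where
    third : ∀ S → S ⊆ L → AllPairs (TwoDist h) S → All (λ w → dist x w ≡ h + h) S → All (λ w → dist y w ≡ h + h) S →
      length L * h ≤ δ + (h + (δ + length S * h)) → Goal
    third [] _ _ _ _ b = finish (≤-trans b (≤-trans (m≤m+n _ (δ + e + h)) (≤-reflexive (sum δ e h))))
      where
      sum : ∀ δ e h → δ + (h + (δ + 0)) + (δ + e + h) ≡ 3 * δ + e + 2 * h
      sum = solve-∀
    third (z ∷ S) S⊆ dS (xz ∷ xS) (yz ∷ yS) b with peel z S dS
    ... | inj₁ t = inj₁ (FarTriple-mono (λ m → there (S⊆ m)) t)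
    ... | inj₂ (U , U⊆ , dU , zU , c) = finish (≤-trans b (≤-trans
        (+-monoʳ-≤ δ (+-monoʳ-≤ h (+-monoʳ-≤ δ (+-monoʳ-≤ h (≤-trans c (+-monoʳ-≤ δ
          (equidistant-bound x y z xy yz xz U dU (All.anti-mono U⊆ xS) (All.anti-mono U⊆ yS) zU)))))))
        (≤-reflexive (sum δ e h))))
      where
      sum : ∀ δ e h → δ + (h + (δ + (h + (δ + e)))) ≡ 3 * δ + e + 2 * h
      sum = solve-∀

-- Weights around the centre

unique⇒allPairs : {A : Set} {P : A → A → Set} {L : List A} → Unique L →
  (∀ x y → x ∈ L → y ∈ L → x ≢ y → P x y) → AllPairs P L
unique⇒allPairs []      p = []
unique⇒allPairs (u ∷ us) p = All.tabulate (λ {y} y∈ → p _ y (here refl) (there y∈) (All.lookup u y∈))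
  ∷ unique⇒allPairs us (λ x y x∈ y∈ → p x y (there x∈) (there y∈))

TwoDist⇒meet≤1 : ∀ h (x y : Word n) → wt x ≡ suc h → wt y ≡ suc h → TwoDist h x y → wt (x ∩ y) ≤ 1
TwoDist⇒meet≤1 h x y wx wy (inj₁ e) = ≤-reflexive (*-cancelˡ-≡ _ 1 2 (+-cancelˡ-≡ (h + h) _ _
  (trans (trans (cong (_+ 2 * wt (x ∩ y)) (sym e)) (trans (dist-wt x y) (cong₂ _+_ wx wy))) (sym (2h+2≡ h)))))
TwoDist⇒meet≤1 h x y wx wy (inj₂ e) = ≤-trans (≤-reflexive meet≡0) z≤n
  where
  meet≡0 : wt (x ∩ y) ≡ 0
  meet≡0 = *-cancelˡ-≡ _ 0 2 (+-cancelˡ-≡ (h + h + 2) _ _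
    (trans (trans (cong (_+ 2 * wt (x ∩ y)) (sym e)) (trans (dist-wt x y) (cong₂ _+_ wx wy)))
      (trans (sym (2h+2≡ h)) (sym (+-identityʳ (h + h + 2))))))

meet≡0⇒dist : ∀ h (x y : Word n) → wt x ≡ suc h → wt y ≡ suc h → wt (x ∩ y) ≡ 0 → dist x y ≡ h + h + 2
meet≡0⇒dist h x y wx wy m = trans (sym (+-identityʳ _)) (trans (cong (λ c → dist x y + 2 * c) (sym m))
  (trans (dist-wt x y) (trans (cong₂ _+_ wx wy) (sym (2h+2≡ h)))))

meet≡1⇒dist : ∀ h (x y : Word n) → wt x ≡ suc h → wt y ≡ suc h → wt (x ∩ y) ≡ 1 → dist x y ≡ h + h
meet≡1⇒dist h x y wx wy m = +-cancelʳ-≡ 2 _ _ (trans (cong (λ c → dist x y + 2 * c) (sym m))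
  (trans (dist-wt x y) (trans (cong₂ _+_ wx wy) (sym (2h+2≡ h)))))

meet≤1⇒TwoDist : ∀ h (x y : Word n) → wt x ≡ suc h → wt y ≡ suc h → wt (x ∩ y) ≤ 1 → TwoDist h x y
meet≤1⇒TwoDist h x y wx wy l with m≤n⇒m<n∨m≡n l
... | inj₁ c<1 = inj₂ (meet≡0⇒dist h x y wx wy (n<1⇒n≡0 c<1))
... | inj₂ c≡1 = inj₁ (meet≡1⇒dist h x y wx wy c≡1)

-- The weights add up to only 2h, so distance at least 2h leaves nothing for the intersection.
low-meets-nothing : ∀ h (z x : Word n) → suc (wt z) ≡ h → wt x ≡ suc h → TwoDist h z x → Disjoint z x
low-meets-nothing h z x wz wx d = *-cancelˡ-≡ _ 0 2 (n≤0⇒n≡0 (+-cancelˡ-≤ (h + h) _ _ (begin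
  h + h + 2 * wt (z ∩ x)         ≤⟨ +-monoˡ-≤ _ (TwoDist⇒≥ h z x d) ⟩
  dist z x + 2 * wt (z ∩ x)      ≡⟨ trans (dist-wt z x) (cong (wt z +_) wx) ⟩
  wt z + suc h                   ≡⟨ trans (+-suc (wt z) h) (cong (_+ h) wz) ⟩
  h + h                          ≡⟨ sym (+-identityʳ (h + h)) ⟩
  h + h + 0                      ∎)))
  where open ≤-Reasoning

module Structure {n h : ℕ} (C : List (Word n))
  (C-dist : ∀ x y → x ∈ C → y ∈ C → x ≢ y → TwoDist h x y) (C-unique : Unique C)
  (a b c : Word n) (a∈ : a ∈ C) (b∈ : b ∈ C) (c∈ : c ∈ C)
  (wa : wt a ≡ suc h) (wb : wt b ≡ suc h) (wc : wt c ≡ suc h)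
  (a⊥b : Disjoint a b) (a⊥c : Disjoint a c) (b⊥c : Disjoint b c) where

  open ThreeBlocks a b c a⊥b a⊥c b⊥c

  -- `Low` is weight h-1, written without truncated subtraction.
  Good Low Bad : Word n → Set
  Good w = wt w ≡ suc h
  Low w = suc (wt w) ≡ h
  Bad w = ¬ Good w × ¬ Low w

  good? : ∀ w → Dec (Good w)
  good? w = wt w ≟ suc h

  low? : ∀ w → Dec (Low w)
  low? w = suc (wt w) ≟ h

  C-pairs : AllPairs (TwoDist h) C
  C-pairs = unique⇒allPairs C-unique C-dist

  notGood good low bad : List (Word n)
  good = filter good? C
  notGood = filter (λ w → ¬? (good? w)) C
  low = filter low? notGood
  bad = filter (λ w → ¬? (low? w)) notGood

  length-C : length C ≡ length good + (length low + length bad)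
  length-C = trans (length-filter-split good? C) (cong (length good +_) (length-filter-split low? notGood))

  record Hits (w x : Word n) : Set where
    field
      hits  : 1 ≤ wt (w ∩ x)
      upper : wt w ≤ suc h + 2 * wt (w ∩ x)

  -- If `w` missed `x`, their distance would be `wt w + suc h`, and the two admissible distances
  -- would make `w` low or good.
  bad-hits : ∀ {w x} → w ∈ C → Bad w → x ∈ C → Good x → Hits w x
  bad-hits {w} {x} w∈ (¬good , ¬low) x∈ wx = record
    { hits = n≢0⇒n>0 (λ s≡0 → miss s≡0 close)
    ; upper = wt-bound (suc h) w x wx (TwoDist⇒≤ h w x close)
    }
    where
    close : TwoDist h w x
    close = C-dist w x w∈ x∈ λ { refl → ¬good wx }
    wt-if-disjoint : wt (w ∩ x) ≡ 0 → wt w + suc h ≡ dist w x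
    wt-if-disjoint s≡0 = trans (cong (wt w +_) (sym wx)) (trans (sym (dist-wt w x))
      (trans (cong (λ s → dist w x + 2 * s) s≡0) (+-identityʳ _)))
    miss : wt (w ∩ x) ≡ 0 → ¬ TwoDist h w x
    miss s≡0 (inj₁ e) = ¬low (+-cancelʳ-≡ h _ _ (trans (sym (+-suc (wt w) h)) (trans (wt-if-disjoint s≡0) e)))
    miss s≡0 (inj₂ e) = ¬good (+-cancelʳ-≡ (suc h) _ _ (trans (wt-if-disjoint s≡0) (trans e (2h+2≡ h))))

  bad∈⁻ : ∀ {w} → w ∈ bad → w ∈ C × Bad w
  bad∈⁻ w∈ =
    let w∈′ , ¬low = ∈-filter⁻ (λ w → ¬? (low? w)) w∈
        w∈C , ¬good = ∈-filter⁻ (λ w → ¬? (good? w)) w∈′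
    in w∈C , ¬good , ¬low

  bounds : ∀ {w} → w ∈ C → Bad w →
    wt (outer w) + wt (w ∩ a) ≤ suc h × wt (outer w) + wt (w ∩ b) ≤ suc h × wt (outer w) + wt (w ∩ c) ≤ suc h
  bounds {w} w∈ bw = outer-bounds (suc h) w (Hits.upper (bad-hits w∈ bw a∈ wa))
    (Hits.upper (bad-hits w∈ bw b∈ wb)) (Hits.upper (bad-hits w∈ bw c∈ wc))

  private
    T : List Trace
    T = cartesianProduct (singletons a) (cartesianProduct (singletons b) (singletons c))

    length-T : length T ≡ cube (suc h)
    length-T = trans (length-cartesianProduct (singletons a) _) (cong₂ _*_
      (trans (length-singletons a) wa)
      (trans (length-cartesianProduct (singletons b) _) (cong₂ _*_
        (trans (length-singletons b) wb) (trans (length-singletons c) wc))))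

    length-traces : length traces ≡ cube (2 ^ suc h)
    length-traces = trans (length-cartesianProduct (subwords a) _) (cong₂ _*_
      (trans (length-subwords a) (cong (2 ^_) wa))
      (trans (length-cartesianProduct (subwords b) _) (cong₂ _*_
        (trans (length-subwords b) (cong (2 ^_) wb)) (trans (length-subwords c) (cong (2 ^_) wc)))))

    -- No trace of a bad word is empty, so an outer part has at most `h` points, and exactly `h`
    -- only if each trace is a single point. This is why `cube (suc h)` is the coefficient of `n` in
    -- `bad-bound`.
    classify : ∀ {w} → w ∈ C → Bad w → wt (outer w) < h ⊎ wt (outer w) ≡ h × trace w ∈ T
    classify {w} w∈ bw = split (m≤n⇒m<n∨m≡n outer≤h)
      where
      bds = bounds w∈ bw
      hit : ∀ x → x ∈ C → Good x → 1 ≤ wt (w ∩ x)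
      hit x x∈ wx = Hits.hits (bad-hits w∈ bw x∈ wx)
      outer≤h : wt (outer w) ≤ h
      outer≤h = ≤-pred (≤-trans (≤-reflexive (+-comm 1 _)) (≤-trans (+-monoʳ-≤ _ (hit a a∈ wa)) (proj₁ bds)))
      single : ∀ x → x ∈ C → Good x → wt (outer w) ≡ h → wt (outer w) + wt (w ∩ x) ≤ suc h → w ∩ x ∈ singletons x
      single x x∈ wx e b = ∈-singletons w x (≤-antisym (+-cancelˡ-≤ h _ 1 (≤-trans
        (subst (λ o → o + wt (w ∩ x) ≤ suc h) e b) (≤-reflexive (+-comm 1 h)))) (hit x x∈ wx))
      split : wt (outer w) < h ⊎ wt (outer w) ≡ h → wt (outer w) < h ⊎ wt (outer w) ≡ h × trace w ∈ T
      split (inj₁ l) = inj₁ l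
      split (inj₂ e) = inj₂ (e , ∈-cartesianProduct⁺ (single a a∈ wa e (proj₁ bds))
        (∈-cartesianProduct⁺ (single b b∈ wb e (proj₁ (proj₂ bds))) (single c c∈ wc e (proj₂ (proj₂ bds)))))

  bad-bound : length bad * h ≤ cube (suc h) * n + cube (2 ^ suc h) * h
  bad-bound = ≤-trans (family-bound h T bad
      (AllPairs.map (λ {v} {w} → TwoDist⇒≥ h v w) (AllPairs.filter⁺ _ (AllPairs.filter⁺ _ C-pairs)))
      (All.tabulate λ w∈ → let w∈C , bw = bad∈⁻ w∈ in classify w∈C bw))
    (≤-reflexive (cong₂ (λ s t → s * n + t * h) length-T length-traces))

  -- Two words of weight h-1 are at distance at most 2h-2.
  low-bound : length low ≤ 1
  low-bound = atMostOne low (AllPairs.filter⁺ low? (AllPairs.filter⁺ _ C-pairs)) (All.all-filter low? notGood)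
    where
    atMostOne : ∀ L → AllPairs (TwoDist h) L → All Low L → length L ≤ 1
    atMostOne []          _             _             = z≤n
    atMostOne (_ ∷ [])    _             _             = s≤s z≤n
    atMostOne (x ∷ y ∷ L) ((d ∷ _) ∷ _) (wx ∷ wy ∷ _) = contradiction (begin-strict
      h + h                        ≤⟨ TwoDist⇒≥ h x y d ⟩
      dist x y                     ≤⟨ m≤m+n (dist x y) _ ⟩
      dist x y + 2 * wt (x ∩ y)    ≡⟨ dist-wt x y ⟩
      wt x + wt y                  <⟨ +-mono-< (≤-reflexive wx) (≤-reflexive wy) ⟩
      h + h                        ∎) (<-irrefl refl)
      where open ≤-Reasoning

  -- One bad word limits all good ones: each of them passes through one of its at most 3(h+1)
  -- points, and the good words through a fixed point are disjoint elsewhere.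
  good-bound : ∀ {w} → w ∈ bad → length good * h ≤ 3 * suc h * n
  good-bound {w} w∈bad = ≤-trans
    (cover-bound {S = λ x y → TwoDist h x y} {Q = Good} (λ i x → x ∋? i) fibre (points w) good
      (AllPairs.filter⁺ good? C-pairs) (All.all-filter good? C) (All.tabulate hit))
    (*-monoˡ-≤ n (≤-trans (≤-reflexive (length-points w)) wt≤))
    where
    w∈C = proj₁ (bad∈⁻ w∈bad)
    bw = proj₂ (bad∈⁻ w∈bad)
    fibre : ∀ i L → AllPairs (TwoDist h) L → All Good L → All (_∋ i) L → length L * h ≤ n
    fibre i L d q r = star-bound i L (pairs L d q) q r
      where
      pairs : ∀ L → AllPairs (TwoDist h) L → All Good L → AllPairs (λ x y → wt (x ∩ y) ≤ 1) L
      pairs []      []      []      = []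
      pairs (x ∷ L) (d ∷ ds) (g ∷ gs) = All.zipWith (λ { {y} (dxy , gy) → TwoDist⇒meet≤1 h x y g gy dxy }) (d , gs) ∷ pairs L ds gs
    hit : ∀ {x} → x ∈ good → Any (λ i → x ∋ i) (points w)
    hit {x} x∈ =
      let x∈C , gx = ∈-filter⁻ good? x∈
          i , p = nonempty (w ∩ x) (λ e → contradiction (subst (1 ≤_) e (Hits.hits (bad-hits w∈C bw x∈C gx))) λ ())
          p₁ , p₂ = ∋-∩⁻ w x p
      in Any.map (λ { refl → p₂ }) (∈-points w p₁)
    wt≤ : wt w ≤ 3 * suc h
    wt≤ = ≤-trans (Hits.upper (bad-hits w∈C bw a∈ wa))
      (≤-trans (+-monoʳ-≤ (suc h) (*-monoʳ-≤ 2 (m+n≤o⇒n≤o (wt (outer w)) (proj₁ (bounds w∈C bw)))))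
        (≤-reflexive (thrice (suc h))))
      where
      thrice : ∀ k → k + 2 * k ≡ 3 * k
      thrice = solve-∀

  bad-or-small : bad ≡ [] ⊎ length C * h ≤ 3 * suc h * n + (h + (cube (suc h) * n + cube (2 ^ suc h) * h))
  bad-or-small = go bad refl
    where
    go : ∀ L → bad ≡ L → bad ≡ [] ⊎ length C * h ≤ 3 * suc h * n + (h + (cube (suc h) * n + cube (2 ^ suc h) * h))
    go []      e = inj₁ e
    go (w ∷ L) e = inj₂ (begin
      length C * h                                         ≡⟨ cong (_* h) length-C ⟩
      (length good + (length low + length bad)) * h        ≡⟨ distribute (length good) (length low) (length bad) h ⟩
      length good * h + (length low * h + length bad * h)  ≤⟨ +-mono-≤ (good-bound (subst (w ∈_) (sym e) (here refl)))
        (+-mono-≤ (≤-trans (*-monoˡ-≤ h low-bound) (≤-reflexive (*-identityˡ h))) bad-bound) ⟩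
      _ ∎)
      where
      open ≤-Reasoning
      distribute : ∀ g l b h → (g + (l + b)) * h ≡ g * h + (l * h + b * h)
      distribute = solve-∀

-- Exchanging blocks

fresh : (E : List (Fin n)) → length E < n → ∃[ i ] (i ∉ E)
fresh {n} E short = ¬∀⟶∃¬ n (_∈ E) (λ i → _∈?_ Fin._≟_ i E) all∈
  where
  all∈ : ¬ (∀ i → i ∈ E)
  -- Positions in `E` would inject the points into a list that is too short.
  all∈ m with i , j , i<j , e ← pigeonhole short (λ i → Any.index (m i)) =
    Fin.<⇒≢ i<j (trans (lookup-index (m i)) (trans (cong (List.lookup E) e) (sym (lookup-index (m j)))))

length-concatMap : {A B : Set} (f : A → List B) (m k : ℕ) → (∀ x → length (f x) ≤ k) →
  ∀ L → length L ≤ m → length (concatMap f L) ≤ m * k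
length-concatMap f m       k b []      l       = z≤n
length-concatMap f (suc m) k b (x ∷ L) (s≤s l) =
  ≤-trans (≤-reflexive (length-++ (f x))) (+-mono-≤ (b x) (length-concatMap f m k b L l))

∈-concatMap : {A B : Set} (f : A → List B) {x : A} {y : B} (L : List A) → x ∈ L → y ∈ f x → y ∈ concatMap f L
∈-concatMap f (_ ∷ L) (here refl) y∈ = ∈-++⁺ˡ y∈
∈-concatMap f (x ∷ L) (there x∈)  y∈ = ∈-++⁺ʳ (f x) (∈-concatMap f L x∈ y∈)

allPairs-lookup : ∀ {L : List (Word n)} → AllPairs (TwoDist h) L → ∀ x y → x ∈ L → y ∈ L → x ≢ y → TwoDist h x y
allPairs-lookup (d ∷ ds) x y (here refl) (here refl) x≢y = contradiction refl x≢y
allPairs-lookup (d ∷ ds) x y (here refl) (there y∈)  x≢y = All.lookup d y∈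
allPairs-lookup {h = h} (d ∷ ds) x y (there x∈) (here refl) x≢y with All.lookup d x∈
... | inj₁ e = inj₁ (trans (dist-sym x y) e)
... | inj₂ e = inj₂ (trans (dist-sym x y) e)
allPairs-lookup {h = h} (d ∷ ds) x y (there x∈)  (there y∈)  x≢y = allPairs-lookup {h = h} ds x y x∈ y∈ x≢y

dist>0⇒≢ : ∀ {x y : Word n} {k} → dist x y ≡ suc k → x ≢ y
dist>0⇒≢ {x = x} e refl = contradiction (trans (sym e) (dist-refl x)) λ ()

-- With `suc h` both distances are positive, so the pairwise distances by themselves exclude
-- repetitions.
is2DistCode : ∀ {h} {L : List (Word n)} → AllPairs (TwoDist (suc h)) L →
  (∃[ x ] ∃[ y ] (x ∈ L × y ∈ L × dist x y ≡ suc h + suc h)) →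
  (∃[ x ] ∃[ y ] (x ∈ L × y ∈ L × dist x y ≡ suc h + suc h + 2)) →
  Is2DistCode (suc h + suc h) (suc h + suc h + 2) L
is2DistCode {h = h} d (x , y , x∈ , y∈ , e) (x′ , y′ , x∈′ , y∈′ , e′) =
  AllPairs.map (λ { (inj₁ e) → dist>0⇒≢ e ; (inj₂ e) → dist>0⇒≢ e }) d
  , allPairs-lookup {h = suc h} d
  , (x , y , x∈ , y∈ , dist>0⇒≢ e , e)
  , (x′ , y′ , x∈′ , y∈′ , dist>0⇒≢ e′ , e′)

data Corner : Set where
  c₀ c₁ c₂ : Corner

next : Corner → Corner
next c₀ = c₁
next c₁ = c₂
next c₂ = c₀

-- Matching on the position of one corner relative to another exploits the cyclic symmetry: three
-- cases stand for nine.
data Position (k : Corner) : Corner → Set where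
  same  : Position k k
  after : Position k (next k)
  third : Position k (next (next k))

position : ∀ k l → Position k l
position c₀ c₀ = same
position c₀ c₁ = after
position c₀ c₂ = third
position c₁ c₀ = third
position c₁ c₁ = same
position c₁ c₂ = after
position c₂ c₀ = after
position c₂ c₁ = third
position c₂ c₂ = same

next³ : ∀ k → next (next (next k)) ≡ k
next³ c₀ = refl
next³ c₁ = refl
next³ c₂ = refl

Meets≤1 : Word n → Word n → Set
Meets≤1 x y = ∀ i j → x ∋ i → y ∋ i → x ∋ j → y ∋ j → i ≡ j

meets≤1⇒wt : (x y : Word n) → Meets≤1 x y → wt (x ∩ y) ≤ 1
meets≤1⇒wt x y m = ≡⇒wt≤1 (x ∩ y) λ i j p q →
  m i j (proj₁ (∋-∩⁻ x y p)) (proj₂ (∋-∩⁻ x y p)) (proj₁ (∋-∩⁻ x y q)) (proj₂ (∋-∩⁻ x y q))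

wt⇒meets≤1 : (x y : Word n) → wt (x ∩ y) ≤ 1 → Meets≤1 x y
wt⇒meets≤1 x y w i j xi yi xj yj = wt≤1⇒≡ (x ∩ y) w (∋-∩⁺ x y xi yi) (∋-∩⁺ x y xj yj)

Triple : ℕ → Set
Triple n = Corner → Fin n

Edge : Triple n → Corner → Word n → Set
Edge K k B = B ∋ K k × B ∋ K (next k)

NoEdge : Triple n → Word n → Set
NoEdge K B = ∀ k → ¬ Edge K k B

edge? : (K : Triple n) (B : Word n) → (∃[ k ] Edge K k B) ⊎ NoEdge K B
edge? K B with one c₀ | one c₁ | one c₂
  where
  one : ∀ k → Dec (Edge K k B)
  one k = (B ∋? K k) ×-dec (B ∋? K (next k))
... | yes e | _     | _     = inj₁ (c₀ , e)
... | no _  | yes e | _     = inj₁ (c₁ , e)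
... | no _  | no _  | yes e = inj₁ (c₂ , e)
... | no p  | no q  | no r  = inj₂ λ { c₀ → p ; c₁ → q ; c₂ → r }

module Exchange {n h : ℕ} (h≤3 : h ≤ 3) (G : List (Word n))
  (G-unique : Unique G) (G-dist : ∀ x y → x ∈ G → y ∈ G → x ≢ y → TwoDist h x y)
  (G-wt : ∀ {x} → x ∈ G → wt x ≡ suc h)
  (z : Word n) (wz : suc (wt z) ≡ h) (z⊥G : ∀ {x} → x ∈ G → Disjoint z x)
  (p : Fin n) (z∋p : z ∋ p) where

  G-meets : ∀ {x y} → x ∈ G → y ∈ G → x ≢ y → Meets≤1 x y
  G-meets {x} {y} x∈ y∈ x≢y = wt⇒meets≤1 x y (TwoDist⇒meet≤1 h x y (G-wt x∈) (G-wt y∈) (G-dist x y x∈ y∈ x≢y))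

  G∌z : ∀ {x i} → x ∈ G → z ∋ i → ¬ x ∋ i
  G∌z {x} x∈ zi xi = wt≡0⇒∌ (z ∩ x) (z⊥G x∈) (∋-∩⁺ z x zi xi)

  record Triangle (K : Triple n) : Set where
    field
      distinct : ∀ k → K k ≢ K (next k)
      noncollinear : ∀ {B} → B ∈ G → ¬ (∀ k → B ∋ K k)
      off-z : ∀ k → ¬ z ∋ K k

  move : Triple n → Corner → Word n → Word n
  move K k B = ins (del B (K (next k))) p

  Moved : Triple n → Word n → Word n → Set
  Moved K B w = ∃[ k ] (Edge K k B × w ≡ move K k B)

  move⁻ : ∀ K k B {i} → move K k B ∋ i → i ≡ p ⊎ (i ≢ K (next k) × B ∋ i)
  move⁻ K k B m with ∋-ins⁻ (del B (K (next k))) p m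
  ... | inj₁ e = inj₁ e
  ... | inj₂ d = inj₂ (∋-del⁻ B (K (next k)) d)

  move-wt : ∀ K k {B} → B ∈ G → Edge K k B → wt (move K k B) ≡ suc h
  move-wt K k {B} B∈ (_ , e) = trans
    (wt-ins (del B (K (next k))) p (λ q → G∌z B∈ z∋p (proj₂ (∋-del⁻ B (K (next k)) q))))
    (trans (wt-del B (K (next k)) e) (G-wt B∈))

  -- Both moved blocks contain `p`, so nothing else may remain common. On the same side, distinct
  -- blocks would share two corners. On different sides the only common point is the shared corner,
  -- and it is traded away by the move of `B` in the case `after` and by the move of `B′` in the
  -- case `third`.
  moves-same : ∀ {K B B′} → Triangle K → B ∈ G → B′ ∈ G → B ≢ B′ →
    ∀ k l → Edge K k B → Edge K l B′ → ∀ {i} → i ≢ K (next k) → i ≢ K (next l) → B ∋ i → ¬ B′ ∋ i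
  moves-same {K} {B} {B′} t B∈ B∈′ B≢B′ k l (e , e⁺) (f , f⁺) {i} i≢ i≢′ Bi Bi′ with position k l
  ... | same  = Triangle.distinct t k (G-meets B∈ B∈′ B≢B′ _ _ e f e⁺ f⁺)
  ... | after = i≢ (G-meets B∈ B∈′ B≢B′ _ _ Bi Bi′ e⁺ f)
  ... | third = i≢′ (G-meets B∈ B∈′ B≢B′ _ _ Bi Bi′ (subst (λ m → B ∋ K m) (sym (next³ k)) e) f⁺)

  block : Triple n → Word n
  block K = ins (ins (ins (del z p) (K c₀)) (K c₁)) (K c₂)

  block∋ : ∀ K k → block K ∋ K k
  block∋ K c₀ = ∋-ins⁺ (ins (ins (del z p) (K c₀)) (K c₁)) (K c₂)
    (∋-ins⁺ (ins (del z p) (K c₀)) (K c₁) (∋-ins-self (del z p) (K c₀)))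
  block∋ K c₁ = ∋-ins⁺ (ins (ins (del z p) (K c₀)) (K c₁)) (K c₂) (∋-ins-self (ins (del z p) (K c₀)) (K c₁))
  block∋ K c₂ = ∋-ins-self (ins (ins (del z p) (K c₀)) (K c₁)) (K c₂)

  block⁻ : ∀ K {i} → block K ∋ i → (∃[ k ] (i ≡ K k)) ⊎ del z p ∋ i
  block⁻ K q with ∋-ins⁻ (ins (ins (del z p) (K c₀)) (K c₁)) (K c₂) q
  ... | inj₁ e = inj₁ (c₂ , e)
  ... | inj₂ q with ∋-ins⁻ (ins (del z p) (K c₀)) (K c₁) q
  ...   | inj₁ e = inj₁ (c₁ , e)
  ...   | inj₂ q with ∋-ins⁻ (del z p) (K c₀) q
  ...     | inj₁ e = inj₁ (c₀ , e)
  ...     | inj₂ q = inj₂ q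

  wt-del-z : suc (suc (wt (del z p))) ≡ h
  wt-del-z = trans (cong suc (wt-del z p z∋p)) wz

  block-wt : ∀ {K} → Triangle K → wt (block K) ≡ suc h
  block-wt {K} t = trans (wt-ins x₂ (K c₂) n₂) (cong suc (trans (wt-ins x₁ (K c₁) n₁)
    (trans (cong suc (wt-ins x₀ (K c₀) (n₀ c₀))) wt-del-z)))
    where
    open Triangle t
    x₀ = del z p
    x₁ = ins x₀ (K c₀)
    x₂ = ins x₁ (K c₁)
    n₀ : ∀ k → ¬ x₀ ∋ K k
    n₀ k q = off-z k (proj₂ (∋-del⁻ z p q))
    n₁ : ¬ x₁ ∋ K c₁
    n₁ q with ∋-ins⁻ x₀ (K c₀) q
    ... | inj₁ e = distinct c₀ (sym e)
    ... | inj₂ q = n₀ c₁ q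
    n₂ : ¬ x₂ ∋ K c₂
    n₂ q with ∋-ins⁻ x₁ (K c₁) q
    ... | inj₁ e = distinct c₁ (sym e)
    ... | inj₂ q with ∋-ins⁻ x₀ (K c₀) q
    ...   | inj₁ e = distinct c₂ e
    ...   | inj₂ q = n₀ c₂ q

  -- Blocks moved for different triples share `p` as well, so they must have been disjoint. The case
  -- `B′ = B` says that no block contains a side of both triples.
  Separated : Triple n → Triple n → Set
  Separated K K′ = ∀ {B B′} → B ∈ G → B′ ∈ G → ∀ k l → Edge K k B → Edge K′ l B′ → ∀ {i} → B ∋ i → ¬ B′ ∋ i

  Fate : Triple n → Triple n → Word n → Word n → Set
  Fate K K′ B w = (w ≡ B × NoEdge K B × NoEdge K′ B) ⊎ Moved K B w ⊎ Moved K′ B w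

  fate-swap : ∀ {K K′ B w} → Fate K K′ B w → Fate K′ K B w
  fate-swap (inj₁ (e , f , g)) = inj₁ (e , g , f)
  fate-swap (inj₂ (inj₁ m)) = inj₂ (inj₂ m)
  fate-swap (inj₂ (inj₂ m)) = inj₂ (inj₁ m)

  fate⁻ : ∀ {K K′ B w i} → Fate K K′ B w → w ∋ i → i ≡ p ⊎ B ∋ i
  fate⁻ (inj₁ (refl , _)) q = inj₂ q
  fate⁻ {K} {B = B} (inj₂ (inj₁ (k , _ , refl))) q with move⁻ K k B q
  ... | inj₁ e       = inj₁ e
  ... | inj₂ (_ , r) = inj₂ r
  fate⁻ {K′ = K} {B = B} (inj₂ (inj₂ (k , _ , refl))) q with move⁻ K k B q
  ... | inj₁ e       = inj₁ e
  ... | inj₂ (_ , r) = inj₂ r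

  -- The points of `z` other than `p` lie on no block, moved or not, so only corners can be common.
  -- A block without a side of `K` has at most one corner. A block moved along side `m` of `K` keeps
  -- only `K m`: it traded `K (next m)`, and by noncollinearity it never had the third corner. A
  -- block moved for `K′` has no side of `K`, by separation.
  block-meets-fate : ∀ {K K′ B w} → Triangle K → Separated K K′ → B ∈ G → Fate K K′ B w → Meets≤1 (block K) w
  block-meets-fate {K} {K′} {B} {w} t sep B∈ f i j bi wi bj wj = unique f (corner bi wi) (corner bj wj)
    where
    open Triangle t
    corner : ∀ {i} → block K ∋ i → w ∋ i → ∃[ k ] (i ≡ K k × B ∋ K k × w ∋ K k)
    corner bi wi with block⁻ K bi | fate⁻ {K} {K′} f wi
    ... | inj₁ (k , refl) | inj₁ e  = contradiction (subst (z ∋_) (sym e) z∋p) (off-z k)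
    ... | inj₁ (k , refl) | inj₂ Bi = k , refl , Bi , wi
    ... | inj₂ d          | inj₁ e  = contradiction e (proj₁ (∋-del⁻ z p d))
    ... | inj₂ d          | inj₂ Bi = contradiction Bi (G∌z B∈ (proj₂ (∋-del⁻ z p d)))
    kept : ∀ m → Edge K m B → w ≡ move K m B → ∀ k → B ∋ K k → w ∋ K k → k ≡ m
    kept m (e , e⁺) refl k Bk wk with position m k
    ... | same  = refl
    ... | after with move⁻ K m B wk
    ...   | inj₁ e′      = contradiction (subst (z ∋_) (sym e′) z∋p) (off-z (next m))
    ...   | inj₂ (k≢ , _) = contradiction refl k≢
    kept m (e , e⁺) refl k Bk wk | third = contradiction all (noncollinear B∈)
      where
      all : ∀ l → B ∋ K l
      all l with position m l
      ... | same  = e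
      ... | after = e⁺
      ... | third = Bk
    noEdge : ¬ (∃[ m ] Edge K m B) → ∀ k l → B ∋ K k → B ∋ K l → K k ≡ K l
    noEdge none k l Bk Bl with position k l
    ... | same  = refl
    ... | after = contradiction (k , Bk , Bl) none
    ... | third = contradiction (next (next k) , Bl , subst (λ m → B ∋ K m) (sym (next³ k)) Bk) none
    unique : ∀ {i j} → Fate K K′ B w → ∃[ k ] (i ≡ K k × B ∋ K k × w ∋ K k) → ∃[ l ] (j ≡ K l × B ∋ K l × w ∋ K l) → i ≡ j
    unique (inj₁ (_ , none , _)) (k , refl , Bk , _) (l , refl , Bl , _) = noEdge (λ (m , e) → none m e) k l Bk Bl
    unique (inj₂ (inj₁ (m , e , eq))) (k , refl , Bk , wk) (l , refl , Bl , wl) =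
      cong K (trans (kept m e eq k Bk wk) (sym (kept m e eq l Bl wl)))
    unique (inj₂ (inj₂ (m , e , _))) (k , refl , Bk , _) (l , refl , Bl , _) =
      noEdge (λ (m′ , e′) → sep B∈ B∈ m′ m e′ e (proj₁ e) (proj₁ e)) k l Bk Bl

  -- An unmoved block misses `p`, so its common points with the other were common before the
  -- exchange. If both blocks have moved, `p` is their only common point.
  fates-meet : ∀ {K K′ B B′ w w′} → Triangle K → Triangle K′ → Separated K K′ → B ∈ G → B′ ∈ G → B ≢ B′ →
    Fate K K′ B w → Fate K K′ B′ w′ → Meets≤1 w w′
  fates-meet {K} {K′} {B} {B′} {w} {w′} t t′ sep B∈ B∈′ B≢B′ f f′ = go f f′
    where
    p∉ : ∀ {x i} → x ∈ G → i ≡ p → ¬ x ∋ i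
    p∉ x∈ refl = G∌z x∈ z∋p
    onlyCommon : ∀ w w′ → (∀ {i} → w ∋ i → w′ ∋ i → B ∋ i × B′ ∋ i) → Meets≤1 w w′
    onlyCommon w w′ c i j wi wi′ wj wj′ = G-meets B∈ B∈′ B≢B′ i j
      (proj₁ (c wi wi′)) (proj₂ (c wi wi′)) (proj₁ (c wj wj′)) (proj₂ (c wj wj′))
    onlyP : ∀ w w′ → (∀ {i} → w ∋ i → w′ ∋ i → i ≡ p) → Meets≤1 w w′
    onlyP w w′ c i j wi wi′ wj wj′ = trans (c wi wi′) (sym (c wj wj′))
    moved : ∀ L L′ k l → (∀ {i} → i ≢ L (next k) → i ≢ L′ (next l) → B ∋ i → ¬ B′ ∋ i) →
      Meets≤1 (move L k B) (move L′ l B′)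
    moved L L′ k l excl = onlyP (move L k B) (move L′ l B′) λ q r → both (move⁻ L k B q) (move⁻ L′ l B′ r)
      where
      both : ∀ {i} → i ≡ p ⊎ (i ≢ L (next k) × B ∋ i) → i ≡ p ⊎ (i ≢ L′ (next l) × B′ ∋ i) → i ≡ p
      both (inj₁ e) _ = e
      both (inj₂ _) (inj₁ e) = e
      both (inj₂ (i≢ , Bi)) (inj₂ (i≢′ , Bi′)) = contradiction Bi′ (excl i≢ i≢′ Bi)
    commonˡ : ∀ {i} → B ∋ i → i ≡ p ⊎ B′ ∋ i → B ∋ i × B′ ∋ i
    commonˡ Bi (inj₁ e) = contradiction Bi (p∉ B∈ e)
    commonˡ Bi (inj₂ q) = Bi , q
    commonʳ : ∀ {i} → i ≡ p ⊎ B ∋ i → B′ ∋ i → B ∋ i × B′ ∋ i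
    commonʳ (inj₁ e) Bi = contradiction Bi (p∉ B∈′ e)
    commonʳ (inj₂ q) Bi = q , Bi
    go : ∀ {w w′} → Fate K K′ B w → Fate K K′ B′ w′ → Meets≤1 w w′
    go {w′ = w′} (inj₁ (refl , _)) f′ = onlyCommon B w′ λ wi wi′ → commonˡ wi (fate⁻ {K} {K′} f′ wi′)
    go {w} f@(inj₂ _) (inj₁ (refl , _)) = onlyCommon w B′ λ wi wi′ → commonʳ (fate⁻ {K} {K′} f wi) wi′
    go (inj₂ (inj₁ (k , e , refl))) (inj₂ (inj₁ (l , e′ , refl))) =
      moved K K k l (moves-same t B∈ B∈′ B≢B′ k l e e′)
    go (inj₂ (inj₁ (k , e , refl))) (inj₂ (inj₂ (l , e′ , refl))) =
      moved K K′ k l λ _ _ → sep B∈ B∈′ k l e e′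
    go (inj₂ (inj₂ (k , e , refl))) (inj₂ (inj₁ (l , e′ , refl))) =
      moved K′ K k l λ _ _ Bi Bi′ → sep B∈′ B∈ l k e′ e Bi′ Bi
    go (inj₂ (inj₂ (k , e , refl))) (inj₂ (inj₂ (l , e′ , refl))) =
      moved K′ K′ k l (moves-same t′ B∈ B∈′ B≢B′ k l e e′)

  -- With disjoint triples the common part lies in `z` without `p`, which has h-2 points; this is
  -- where h ≤ 3 enters.
  blocks-meet : ∀ {K K′} → Triangle K → Triangle K′ → (∀ k l → K k ≢ K′ l) → Meets≤1 (block K) (block K′)
  blocks-meet {K} {K′} t t′ K≢K′ i j bi bi′ bj bj′ =
    wt≤1⇒≡ (del z p) (≤-pred (≤-pred (≤-trans (≤-reflexive wt-del-z) h≤3))) (in-z bi bi′) (in-z bj bj′)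
    where
    in-z : ∀ {i} → block K ∋ i → block K′ ∋ i → del z p ∋ i
    in-z b b′ with block⁻ K b | block⁻ K′ b′
    ... | inj₂ q          | _             = q
    ... | inj₁ (k , refl) | inj₁ (l , e)  = contradiction e (K≢K′ k l)
    ... | inj₁ (k , refl) | inj₂ q        = q

  module _ (K K′ : Triple n) where

    -- A block contains at most one side of a triangle, and none contains sides of two separated
    -- triples, so in the intended use the order of the tests does not affect the result.
    adjust : Word n → Word n
    adjust B with edge? K B | edge? K′ B
    ... | inj₁ (k , _) | _            = move K k B
    ... | inj₂ _       | inj₁ (k , _) = move K′ k B
    ... | inj₂ _       | inj₂ _       = B

    fate : ∀ B → Fate K K′ B (adjust B)
    fate B with edge? K B | edge? K′ B
    ... | inj₁ (k , e) | _            = inj₂ (inj₁ (k , e , refl))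
    ... | inj₂ _       | inj₁ (k , e) = inj₂ (inj₂ (k , e , refl))
    ... | inj₂ f       | inj₂ g       = inj₁ (refl , f , g)

    adjust-fixed : ∀ {B} → NoEdge K B → NoEdge K′ B → adjust B ≡ B
    adjust-fixed {B} f g with fate B
    ... | inj₁ (e , _) = e
    ... | inj₂ (inj₁ (k , e , _)) = contradiction e (f k)
    ... | inj₂ (inj₂ (k , e , _)) = contradiction e (g k)

    adjust-wt : ∀ {B} → B ∈ G → wt (adjust B) ≡ suc h
    adjust-wt {B} B∈ with fate B
    ... | inj₁ (e , _) = trans (cong wt e) (G-wt B∈)
    ... | inj₂ (inj₁ (k , e , eq)) = trans (cong wt eq) (move-wt K k B∈ e)
    ... | inj₂ (inj₂ (k , e , eq)) = trans (cong wt eq) (move-wt K′ k B∈ e)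

    exchanged : List (Word n)
    exchanged = block K ∷ block K′ ∷ map adjust G

    exchanged-pairs : Triangle K → Triangle K′ → Separated K K′ → (∀ k l → K k ≢ K′ l) → AllPairs (TwoDist h) exchanged
    exchanged-pairs t t′ sep K≢K′ =
      (close (block K) (block K′) (block-wt t) (block-wt t′) (blocks-meet t t′ K≢K′)
        ∷ All.map⁺ (All.tabulate λ {B} B∈ → close (block K) (adjust B) (block-wt t) (adjust-wt B∈) (block-meets-fate t sep B∈ (fate B))))
      ∷ All.map⁺ (All.tabulate λ {B} B∈ → close (block K′) (adjust B) (block-wt t′) (adjust-wt B∈)
          (block-meets-fate t′ (λ B∈ B∈′ k l e e′ Bi Bi′ → sep B∈′ B∈ l k e′ e Bi′ Bi) B∈ (fate-swap {K} {K′} (fate B))))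
      ∷ AllPairs.map⁺ (unique⇒allPairs G-unique λ B B′ B∈ B∈′ B≢B′ →
          close (adjust B) (adjust B′) (adjust-wt B∈) (adjust-wt B∈′) (fates-meet t t′ sep B∈ B∈′ B≢B′ (fate B) (fate B′)))
      where
      close : ∀ x y → wt x ≡ suc h → wt y ≡ suc h → Meets≤1 x y → TwoDist h x y
      close x y wx wy m = meet≤1⇒TwoDist h x y wx wy (meets≤1⇒wt x y m)

-- The numbers of points to be avoided when choosing the first and the second triple: near-bound counts z,
-- two blocks, the first triple and its three lines; far-bound adds the blocks joining these to the second triple.
near-bound far-bound : ℕ → ℕ
near-bound h = 6 * h + 8
far-bound h = near-bound h + (2 + (suc h + (near-bound h * suc h + near-bound h * suc h)))

-- Choice of two triples far apart

module Augment {n h : ℕ} (h≤3 : suc h ≤ 3) (G : List (Word n))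
  (G-unique : Unique G) (G-dist : ∀ x y → x ∈ G → y ∈ G → x ≢ y → TwoDist (suc h) x y)
  (G-wt : ∀ {x} → x ∈ G → wt x ≡ suc (suc h))
  (z : Word n) (wz : suc (wt z) ≡ suc h) (z⊥G : ∀ {x} → x ∈ G → Disjoint z x)
  (p : Fin n) (z∋p : z ∋ p)
  (a₁ a₂ : Word n) (a₁∈ : a₁ ∈ G) (a₂∈ : a₂ ∈ G) (a₁⊥a₂ : Disjoint a₁ a₂)
  (large : far-bound (suc h) < n) where

  open Exchange h≤3 G G-unique G-dist G-wt z wz z⊥G p z∋p

  -- The conditions on `a₁` and `a₂` make both distances occur after the exchange. Neither contains
  -- a side of either triple, so both stay in place and remain disjoint; and `a₁` passes through the
  -- corner `K c₀`, so the new block on `K` meets it in exactly one point.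
  record Configuration : Set where
    field
      K K′ : Triple n
      triangle  : Triangle K
      triangle′ : Triangle K′
      separated : Separated K K′
      K≢K′ : ∀ k l → K k ≢ K′ l
      a₁∋  : a₁ ∋ K c₀
      a₁∌b : ¬ a₁ ∋ K c₁
      a₁∌c : ¬ a₁ ∋ K c₂
      a₂∌b : ¬ a₂ ∋ K c₁
      a₂∌c : ¬ a₂ ∋ K c₂
      a₁∌K′ : ∀ k → ¬ a₁ ∋ K′ k
      a₂∌K′ : ∀ k → ¬ a₂ ∋ K′ k

  private
    both? : ∀ (u v : Fin n) (B : Word n) → Dec (B ∋ u × B ∋ v)
    both? u v B = (B ∋? u) ×-dec (B ∋? v)

  line : Fin n → Fin n → List (Fin n)
  line u v with Any.any? (both? u v) G
  ... | yes q = points (proj₁ (find q))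
  ... | no  _ = []

  line-length : ∀ u v → length (line u v) ≤ suc (suc h)
  line-length u v with Any.any? (both? u v) G
  ... | yes q = ≤-reflexive (trans (length-points (proj₁ (find q))) (G-wt (proj₁ (proj₂ (find q)))))
  ... | no  _ = z≤n

  -- Distinct points lie on at most one block, so the block found by the search can only be `B`.
  ∈-line : ∀ {u v i B} → u ≢ v → B ∈ G → B ∋ u → B ∋ v → B ∋ i → i ∈ line u v
  ∈-line {u} {v} {i} {B} u≢v B∈ Bu Bv Bi with Any.any? (both? u v) G
  ... | no ¬q = contradiction (Any.map (λ { refl → Bu , Bv }) B∈) ¬q
  ... | yes q with find q
  ...   | B′ , B∈′ , Bu′ , Bv′ with B ≟ʷ B′
  ...     | yes refl = ∈-points B Bi
  ...     | no B≢B′ = contradiction (G-meets B∈ B∈′ B≢B′ u v Bu Bu′ Bv Bv′) u≢v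

  private module Choice where

    base : List (Fin n)
    base = points z ++ (points a₁ ++ points a₂)

    k = suc h
    ν = near-bound k

    base-length : length base ≤ 3 * k + 2
    base-length = begin
      length base                                              ≡⟨ trans (length-++ (points z))
        (cong (length (points z) +_) (length-++ (points a₁))) ⟩
      length (points z) + (length (points a₁) + length (points a₂)) ≡⟨ cong₂ _+_ (length-points z)
        (cong₂ _+_ (trans (length-points a₁) (G-wt a₁∈)) (trans (length-points a₂) (G-wt a₂∈))) ⟩
      wt z + (suc k + suc k)                                   ≤⟨ +-monoˡ-≤ _ (≤-trans (n≤1+n (wt z)) (≤-reflexive wz)) ⟩
      k + (suc k + suc k)                                      ≡⟨ sum k ⟩
      3 * k + 2                                                ∎
      where
      open ≤-Reasoning
      sum : ∀ k → k + (suc k + suc k) ≡ 3 * k + 2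
      sum = solve-∀

    fresh≤ : (E : List (Fin n)) → length E ≤ far-bound k → ∃[ i ] (i ∉ E)
    fresh≤ E l = fresh E (≤-<-trans l large)

    weaken : ∀ {l} m → l ≤ m → m ≤ ν → l ≤ far-bound k
    weaken m l m≤ = ≤-trans l (≤-trans m≤ (m≤m+n ν _))

    ∉z : ∀ {i E} → i ∉ base ++ E → ¬ z ∋ i
    ∉z i∉ q = i∉ (∈-++⁺ˡ (∈-++⁺ˡ (∈-points z q)))
    ∉a₁ : ∀ {i E} → i ∉ base ++ E → ¬ a₁ ∋ i
    ∉a₁ i∉ q = i∉ (∈-++⁺ˡ (∈-++⁺ʳ (points z) (∈-++⁺ˡ (∈-points a₁ q))))
    ∉a₂ : ∀ {i E} → i ∉ base ++ E → ¬ a₂ ∋ i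
    ∉a₂ i∉ q = i∉ (∈-++⁺ˡ (∈-++⁺ʳ (points z) (∈-++⁺ʳ (points a₁) (∈-points a₂ q))))

    pick-a : ∃[ i ] (a₁ ∋ i)
    pick-a = nonempty a₁ (λ e → contradiction (trans (sym e) (G-wt a₁∈)) λ ())
    a = proj₁ pick-a
    a₁∋a = proj₂ pick-a

    pick-b : ∃[ i ] (i ∉ base ++ [])
    pick-b = fresh≤ (base ++ []) (weaken (3 * k + 2) (≤-trans (≤-reflexive (trans (length-++ base) (+-identityʳ _))) base-length)
      (≤-trans (m≤m+n (3 * k + 2) (3 * k + 6)) (≤-reflexive (sum k))))
      where
      sum : ∀ k → 3 * k + 2 + (3 * k + 6) ≡ 6 * k + 8
      sum = solve-∀
    b = proj₁ pick-b
    b∉ = proj₂ pick-b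

    pick-c : ∃[ i ] (i ∉ base ++ (b ∷ line a b))
    pick-c = fresh≤ (base ++ (b ∷ line a b)) (weaken (3 * k + 2 + suc (suc k))
      (≤-trans (≤-reflexive (length-++ base)) (+-mono-≤ base-length (s≤s (line-length a b))))
      (≤-trans (m≤m+n (3 * k + 2 + suc (suc k)) (2 * k + 4)) (≤-reflexive (sum k))))
      where
      sum : ∀ k → 3 * k + 2 + suc (suc k) + (2 * k + 4) ≡ 6 * k + 8
      sum = solve-∀
    c = proj₁ pick-c
    c∉ = proj₂ pick-c

    K : Triple n
    K c₀ = a
    K c₁ = b
    K c₂ = c

    distinct : ∀ l → K l ≢ K (next l)
    distinct c₀ e = ∉a₁ b∉ (subst (a₁ ∋_) e a₁∋a)
    distinct c₁ e = c∉ (∈-++⁺ʳ base (here (sym e)))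
    distinct c₂ e = ∉a₁ c∉ (subst (a₁ ∋_) (sym e) a₁∋a)

    triangle : Triangle K
    triangle = record
      { distinct = distinct
      ; noncollinear = λ B∈ all → c∉ (∈-++⁺ʳ base (there (∈-line (distinct c₀) B∈ (all c₀) (all c₁) (all c₂))))
      ; off-z = λ { c₀ q → G∌z a₁∈ q a₁∋a ; c₁ → ∉z b∉ ; c₂ → ∉z c∉ }
      }

    U : List (Fin n)
    U = base ++ (a ∷ b ∷ c ∷ (line a b ++ (line b c ++ line c a)))

    U-length : length U ≤ ν
    U-length = begin
      length U                                                       ≡⟨ length-++ base ⟩
      length base + (3 + length (line a b ++ (line b c ++ line c a))) ≡⟨ cong (λ l → length base + (3 + l))
        (trans (length-++ (line a b)) (cong (length (line a b) +_) (length-++ (line b c)))) ⟩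
      length base + (3 + (length (line a b) + (length (line b c) + length (line c a))))
                                                                     ≤⟨ +-mono-≤ base-length
        (+-monoʳ-≤ 3 (+-mono-≤ (line-length a b) (+-mono-≤ (line-length b c) (line-length c a)))) ⟩
      3 * k + 2 + (3 + (suc k + (suc k + suc k)))                    ≡⟨ sum k ⟩
      6 * k + 8                                                      ∎
      where
      open ≤-Reasoning
      sum : ∀ k → 3 * k + 2 + (3 + (suc k + (suc k + suc k))) ≡ 6 * k + 8
      sum = solve-∀

    K∈U : ∀ l → K l ∈ U
    K∈U c₀ = ∈-++⁺ʳ base (here refl)
    K∈U c₁ = ∈-++⁺ʳ base (there (here refl))
    K∈U c₂ = ∈-++⁺ʳ base (there (there (here refl)))

    edge⊆U : ∀ {B} → B ∈ G → ∀ l → Edge K l B → ∀ {i} → B ∋ i → i ∈ U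
    edge⊆U B∈ l (e , e⁺) Bi = ∈-++⁺ʳ base (there (there (there (on-line l (∈-line (distinct l) B∈ e e⁺ Bi)))))
      where
      on-line : ∀ l {i} → i ∈ line (K l) (K (next l)) → i ∈ line a b ++ (line b c ++ line c a)
      on-line c₀ m = ∈-++⁺ˡ m
      on-line c₁ m = ∈-++⁺ʳ (line a b) (∈-++⁺ˡ m)
      on-line c₂ m = ∈-++⁺ʳ (line a b) (∈-++⁺ʳ (line b c) m)

    -- These are the points on blocks joining `u` to `U`. A block through `u` and a point outside
    -- `reach u` misses `U` when `u` is outside `U`, whereas `U` contains every block on a side of
    -- `K`; `separated` follows.
    reach : Fin n → List (Fin n)
    reach u = concatMap (line u) U

    reach-length : ∀ u → length (reach u) ≤ ν * suc k
    reach-length u = length-concatMap (line u) ν (suc k) (line-length u) U U-length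

    ∈-reach : ∀ {u v i B} → u ∉ U → i ∈ U → B ∈ G → B ∋ u → B ∋ i → B ∋ v → v ∈ reach u
    ∈-reach {u} {i = i} u∉ i∈ B∈ Bu Bi Bv =
      ∈-concatMap (line u) U i∈ (∈-line (λ u≡i → u∉ (subst (_∈ U) (sym u≡i) i∈)) B∈ Bu Bi Bv)

    pick-a′ : ∃[ i ] (i ∉ U)
    pick-a′ = fresh≤ U (weaken ν U-length ≤-refl)
    a′ = proj₁ pick-a′

    pick-b′ : ∃[ i ] (i ∉ U ++ (a′ ∷ reach a′))
    pick-b′ = fresh≤ (U ++ (a′ ∷ reach a′)) (≤-trans (≤-reflexive (length-++ U))
      (≤-trans (+-mono-≤ U-length (s≤s (reach-length a′)))
        (+-monoʳ-≤ ν (s≤s (≤-trans (m≤m+n (ν * suc k) (suc (suc k + ν * suc k))) (≤-reflexive (sum (ν * suc k) (suc k))))))))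
      where
      sum : ∀ r s → r + suc (s + r) ≡ suc (s + (r + r))
      sum = solve-∀
    b′ = proj₁ pick-b′
    b′∉ = proj₂ pick-b′

    pick-c′ : ∃[ i ] (i ∉ U ++ (a′ ∷ b′ ∷ (line a′ b′ ++ (reach a′ ++ reach b′))))
    pick-c′ = fresh≤ (U ++ (a′ ∷ b′ ∷ (line a′ b′ ++ (reach a′ ++ reach b′)))) (≤-trans
      (≤-reflexive (trans (length-++ U) (cong (λ l → length U + (2 + l))
        (trans (length-++ (line a′ b′)) (cong (length (line a′ b′) +_) (length-++ (reach a′)))))))
      (+-mono-≤ U-length (+-monoʳ-≤ 2 (+-mono-≤ (line-length a′ b′) (+-mono-≤ (reach-length a′) (reach-length b′))))))
    c′ = proj₁ pick-c′
    c′∉ = proj₂ pick-c′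

    K′ : Triple n
    K′ c₀ = a′
    K′ c₁ = b′
    K′ c₂ = c′

    K′∉U : ∀ l → K′ l ∉ U
    K′∉U c₀ = proj₂ pick-a′
    K′∉U c₁ m = b′∉ (∈-++⁺ˡ m)
    K′∉U c₂ m = c′∉ (∈-++⁺ˡ m)

    distinct′ : ∀ l → K′ l ≢ K′ (next l)
    distinct′ c₀ e = b′∉ (∈-++⁺ʳ U (here (sym e)))
    distinct′ c₁ e = c′∉ (∈-++⁺ʳ U (there (here (sym e))))
    distinct′ c₂ e = c′∉ (∈-++⁺ʳ U (here e))

    triangle′ : Triangle K′
    triangle′ = record
      { distinct = distinct′
      ; noncollinear = λ B∈ all → c′∉ (∈-++⁺ʳ U (there (there (∈-++⁺ˡ (∈-line (distinct′ c₀) B∈ (all c₀) (all c₁) (all c₂))))))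
      ; off-z = λ l → ∉z (K′∉U l)
      }

    separated : Separated K K′
    separated {B} {B′} B∈ B∈′ l l′ e e′ {i} Bi Bi′ = clash l′ e′
      where
      i∈U : i ∈ U
      i∈U = edge⊆U B∈ l e Bi
      clash : ∀ l′ → ¬ Edge K′ l′ B′
      clash c₀ (Ba , Bb) = b′∉ (∈-++⁺ʳ U (there (∈-reach (K′∉U c₀) i∈U B∈′ Ba Bi′ Bb)))
      clash c₁ (Bb , Bc) = c′∉ (∈-++⁺ʳ U (there (there (∈-++⁺ʳ (line a′ b′) (∈-++⁺ʳ (reach a′)
        (∈-reach (K′∉U c₁) i∈U B∈′ Bb Bi′ Bc))))))
      clash c₂ (Bc , Ba) = c′∉ (∈-++⁺ʳ U (there (there (∈-++⁺ʳ (line a′ b′) (∈-++⁺ˡ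
        (∈-reach (K′∉U c₀) i∈U B∈′ Ba Bi′ Bc))))))

  configuration : Configuration
  configuration = let open Choice in record
    { K = K
    ; K′ = K′
    ; triangle = triangle
    ; triangle′ = triangle′
    ; separated = separated
    ; K≢K′ = λ l l′ e → K′∉U l′ (subst (_∈ U) e (K∈U l))
    ; a₁∋ = a₁∋a
    ; a₁∌b = ∉a₁ b∉
    ; a₁∌c = ∉a₁ c∉
    ; a₂∌b = ∉a₂ b∉
    ; a₂∌c = ∉a₂ c∉
    ; a₁∌K′ = λ l → ∉a₁ (K′∉U l)
    ; a₂∌K′ = λ l → ∉a₂ (K′∉U l)
    }

  module Result (conf : Configuration) where
    open Configuration conf

    augmented : List (Word n)
    augmented = exchanged K K′

    augmented-length : length augmented ≡ 2 + length G
    augmented-length = cong (2 +_) (length-map (adjust K K′) G)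

    private
      no-edge : ∀ {B} → ¬ B ∋ K c₁ → ¬ B ∋ K c₂ → NoEdge K B
      no-edge ¬b ¬c c₀ (_ , q) = ¬b q
      no-edge ¬b ¬c c₁ (q , _) = ¬b q
      no-edge ¬b ¬c c₂ (q , _) = ¬c q

      unmoved : ∀ {B} → ¬ B ∋ K c₁ → ¬ B ∋ K c₂ → (∀ l → ¬ B ∋ K′ l) → adjust K K′ B ≡ B
      unmoved {B} ¬b ¬c ¬K′ = adjust-fixed K K′ {B} (no-edge {B} ¬b ¬c) (λ l q → ¬K′ l (proj₁ q))

      kept : ∀ {B} → B ∈ G → adjust K K′ B ≡ B → B ∈ augmented
      kept B∈ e = there (there (subst (_∈ map (adjust K K′) G) e (∈-map⁺ (adjust K K′) B∈)))

      a₁-unmoved : adjust K K′ a₁ ≡ a₁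
      a₁-unmoved = unmoved a₁∌b a₁∌c a₁∌K′

      meet≡1 : wt (block K ∩ a₁) ≡ 1
      meet≡1 = ≤-antisym
        (meets≤1⇒wt (block K) a₁ (block-meets-fate triangle separated a₁∈
          (subst (Fate K K′ a₁) a₁-unmoved (fate K K′ a₁))))
        (n≢0⇒n>0 λ e → wt≡0⇒∌ (block K ∩ a₁) e (∋-∩⁺ (block K) a₁ (block∋ K c₀) a₁∋))

    augmented-code : Is2DistCode (suc h + suc h) (suc h + suc h + 2) augmented
    augmented-code = is2DistCode (exchanged-pairs K K′ triangle triangle′ separated K≢K′)
      (block K , a₁ , here refl , kept a₁∈ a₁-unmoved
        , meet≡1⇒dist (suc h) (block K) a₁ (block-wt triangle) (G-wt a₁∈) meet≡1)
      (a₁ , a₂ , kept a₁∈ a₁-unmoved , kept a₂∈ (unmoved a₂∌b a₂∌c a₂∌K′)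
        , meet≡0⇒dist (suc h) a₁ a₂ (G-wt a₁∈) (G-wt a₂∈) a₁⊥a₂)

-- Transversal designs

dist-++ : ∀ {m} (x y : Word m) (x′ y′ : Word n) → dist (x ⧺ x′) (y ⧺ y′) ≡ dist x y + dist x′ y′
dist-++ []          []          x′ y′ = refl
dist-++ (true ∷ x)  (true ∷ y)  x′ y′ = dist-++ x y x′ y′
dist-++ (true ∷ x)  (false ∷ y) x′ y′ = cong suc (dist-++ x y x′ y′)
dist-++ (false ∷ x) (true ∷ y)  x′ y′ = cong suc (dist-++ x y x′ y′)
dist-++ (false ∷ x) (false ∷ y) x′ y′ = dist-++ x y x′ y′

-- Only meaningful for k < m: an index out of range gives the zero word.
onehot : ∀ m → ℕ → Word m
onehot zero    _       = []
onehot (suc m) zero    = true ∷ zeros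
onehot (suc m) (suc k) = false ∷ onehot m k

wt-onehot : ∀ {m k} → k < m → wt (onehot m k) ≡ 1
wt-onehot {suc m} {zero}  _       = cong suc (wt-zeros m)
wt-onehot {suc m} {suc k} (s≤s l) = wt-onehot l

dist-zerosˡ : (x : Word n) → dist zeros x ≡ wt x
dist-zerosˡ []          = refl
dist-zerosˡ (true ∷ x)  = cong suc (dist-zerosˡ x)
dist-zerosˡ (false ∷ x) = dist-zerosˡ x

dist-onehot : ∀ {m k l} → k < m → l < m → k ≢ l → dist (onehot m k) (onehot m l) ≡ 2
dist-onehot {suc m} {zero}  {zero}  _ _ k≢l = contradiction refl k≢l
dist-onehot {suc m} {zero}  {suc l} _ (s≤s l<) _ = cong suc (trans (dist-zerosˡ (onehot m l)) (wt-onehot l<))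
dist-onehot {suc m} {suc k} {zero}  (s≤s k<) _ _ =
  cong suc (trans (dist-sym (onehot m k) zeros) (trans (dist-zerosˡ (onehot m k)) (wt-onehot k<)))
dist-onehot {suc m} {suc k} {suc l} (s≤s k<) (s≤s l<) k≢l = dist-onehot k< l< (λ e → k≢l (cong suc e))

grid : ℕ → List (ℕ × ℕ)
grid m = cartesianProduct (upTo m) (upTo m)

length-grid : ∀ m → length (grid m) ≡ m * m
length-grid m = trans (length-cartesianProduct (upTo m) (upTo m)) (cong₂ _*_ (length-upTo m) (length-upTo m))

grid-code : ∀ m (w : ℕ → ℕ → Word n) →
  (∀ {x y x′ y′} → x < m → y < m → x′ < m → y′ < m → ¬ (x ≡ x′ × y ≡ y′) → TwoDist (suc h) (w x y) (w x′ y′)) →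
  (∃[ x ] ∃[ y ] (x < m × y < m × dist (w 0 0) (w x y) ≡ suc h + suc h)) →
  (∃[ x ] ∃[ y ] (x < m × y < m × dist (w 0 0) (w x y) ≡ suc h + suc h + 2)) →
  0 < m →
  ∃[ C ] (Is2DistCode (suc h + suc h) (suc h + suc h + 2) C × length C ≡ m * m)
grid-code {n} {h} m w close (x , y , x< , y< , e) (x′ , y′ , x<′ , y<′ , e′) 0<m =
  C , is2DistCode pairs
      (w 0 0 , w x y , member 0<m 0<m , member x< y< , e)
      (w 0 0 , w x′ y′ , member 0<m 0<m , member x<′ y<′ , e′)
    , trans (length-map word (grid m)) (length-grid m)
  where
  word : ℕ × ℕ → Word n
  word (x , y) = w x y
  C = map word (grid m)
  member : ∀ {x y} → x < m → y < m → w x y ∈ C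
  member x< y< = ∈-map⁺ word (∈-cartesianProduct⁺ (∈-upTo⁺ x<) (∈-upTo⁺ y<))
  pairs : AllPairs (TwoDist (suc h)) C
  pairs = AllPairs.map⁺ (unique⇒allPairs′ (Unique.cartesianProduct⁺ (Unique.upTo⁺ m) (Unique.upTo⁺ m)))
    where
    unique⇒allPairs′ : Unique (grid m) → AllPairs (λ p q → TwoDist (suc h) (word p) (word q)) (grid m)
    unique⇒allPairs′ u = unique⇒allPairs u λ { (x , y) (x′ , y′) p∈ q∈ p≢q →
      let x∈ , y∈ = ∈-cartesianProduct⁻ (upTo m) (upTo m) p∈
          x∈′ , y∈′ = ∈-cartesianProduct⁻ (upTo m) (upTo m) q∈
      in close (∈-upTo⁻ x∈) (∈-upTo⁻ y∈) (∈-upTo⁻ x∈′) (∈-upTo⁻ y∈′) (λ { (refl , refl) → p≢q refl }) }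

-- With equal remainders, different quotients would put the two sums at least `m` apart, although
-- `a` and `b` are below `m`.
%-cancelˡ : ∀ m .{{_ : NonZero m}} x {a b} → a < m → b < m → (x + a) % m ≡ (x + b) % m → a ≡ b
%-cancelˡ m x {a} {b} a< b< e = go (<-cmp ((x + a) / m) ((x + b) / m))
  where
  less : ∀ {a b} → b < m → (x + a) % m ≡ (x + b) % m → ¬ ((x + a) / m < (x + b) / m)
  less {a} {b} b< e q = <⇒≱ b< (+-cancelˡ-≤ x _ _ (begin
    x + m                                  ≤⟨ +-monoˡ-≤ m (m≤m+n x a) ⟩
    x + a + m                              ≡⟨ cong (_+ m) (m≡m%n+[m/n]*n (x + a) m) ⟩
    (x + a) % m + (x + a) / m * m + m      ≡⟨ trans (+-assoc ((x + a) % m) _ m) (cong₂ _+_ e (+-comm _ m)) ⟩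
    (x + b) % m + suc ((x + a) / m) * m    ≤⟨ +-monoʳ-≤ ((x + b) % m) (*-monoˡ-≤ m q) ⟩
    (x + b) % m + (x + b) / m * m          ≡⟨ sym (m≡m%n+[m/n]*n (x + b) m) ⟩
    x + b                                  ∎))
    where open ≤-Reasoning
  go : Tri ((x + a) / m < (x + b) / m) ((x + a) / m ≡ (x + b) / m) ((x + b) / m < (x + a) / m) → a ≡ b
  go (tri< q _ _) = contradiction q (less b< e)
  go (tri> _ _ q) = contradiction q (less a< (sym e))
  go (tri≈ _ q _) = +-cancelˡ-≡ x a b (trans (m≡m%n+[m/n]*n (x + a) m)
    (trans (cong₂ (λ r s → r + s * m) e q) (sym (m≡m%n+[m/n]*n (x + b) m))))

-- The transversal design {x, y, x + y mod m}.
triple-code : ∀ m r → 3 ≤ m → ∃[ C ] (Is2DistCode {m + (m + (m + r))} 4 6 C × length C ≡ m * m)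
triple-code m@(suc (suc (suc _))) r (s≤s (s≤s (s≤s _))) = grid-code {h = 1} m w close
  (1 , 0 , s≤s (s≤s z≤n) , s≤s z≤n , total {0} {0} {1} {0} 2 0 2 (dist-onehot {m} (s≤s z≤n) (s≤s (s≤s z≤n)) λ ())
    (dist-refl (onehot m 0)) (dist-onehot {m} (s≤s z≤n) (s≤s (s≤s z≤n)) λ ()))
  -- The sums 0 and 2 of `(0 , 0)` and `(1 , 1)` stay distinct modulo `m` because `m` is at least 3.
  (1 , 1 , s≤s (s≤s z≤n) , s≤s (s≤s z≤n) , total {0} {0} {1} {1} 2 2 2 (dist-onehot {m} (s≤s z≤n) (s≤s (s≤s z≤n)) λ ())
    (dist-onehot {m} (s≤s z≤n) (s≤s (s≤s z≤n)) λ ()) (dist-onehot {m} (s≤s z≤n) (s≤s (s≤s (s≤s z≤n))) λ ()))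
  (s≤s z≤n)
  where
  w : ℕ → ℕ → Word (m + (m + (m + r)))
  w x y = onehot m x ⧺ (onehot m y ⧺ (onehot m ((x + y) % m) ⧺ zeros))
  total : ∀ {x y x′ y′} d₁ d₂ d₃ → dist (onehot m x) (onehot m x′) ≡ d₁ → dist (onehot m y) (onehot m y′) ≡ d₂ →
    dist (onehot m ((x + y) % m)) (onehot m ((x′ + y′) % m)) ≡ d₃ → dist (w x y) (w x′ y′) ≡ d₁ + (d₂ + (d₃ + 0))
  total {x} {y} {x′} {y′} _ _ _ e₁ e₂ e₃ = trans (dist-++ (onehot m x) (onehot m x′) _ _) (cong₂ _+_ e₁
    (trans (dist-++ (onehot m y) (onehot m y′) _ _) (cong₂ _+_ e₂
      (trans (dist-++ (onehot m ((x + y) % m)) (onehot m ((x′ + y′) % m)) (zeros {r}) zeros) (cong₂ _+_ e₃ (dist-refl (zeros {r})))))))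
  -- Any two of x, y and x + y mod m determine the third, so distinct words agree in at most one of
  -- the three groups; each group where they differ adds 2 to the distance.
  close : ∀ {x y x′ y′} → x < m → y < m → x′ < m → y′ < m → ¬ (x ≡ x′ × y ≡ y′) → TwoDist 2 (w x y) (w x′ y′)
  close {x} {y} {x′} {y′} x< y< x<′ y<′ ne
    with x ≟ x′ | y ≟ y′ | (x + y) % m ≟ (x′ + y′) % m
  ... | yes refl | yes refl | _ = contradiction (refl , refl) ne
  ... | yes refl | no y≢ | yes e = contradiction (%-cancelˡ m x y< y<′ e) y≢
  ... | no x≢ | yes refl | yes e = contradiction (%-cancelˡ m y x< x<′
          (trans (cong (_% m) (+-comm y x)) (trans e (cong (_% m) (+-comm x′ y))))) x≢
  ... | yes refl | no y≢ | no s≢ = inj₁ (total {x} {y} {x} {y′} 0 2 2 (dist-refl (onehot m x)) (dist-onehot y< y<′ y≢)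
          (dist-onehot (m%n<n (x + y) m) (m%n<n (x + y′) m) s≢))
  ... | no x≢ | yes refl | no s≢ = inj₁ (total {x} {y} {x′} {y} 2 0 2 (dist-onehot x< x<′ x≢) (dist-refl (onehot m y))
          (dist-onehot (m%n<n (x + y) m) (m%n<n (x′ + y) m) s≢))
  ... | no x≢ | no y≢ | yes e = inj₁ (total {x} {y} {x′} {y′} 2 2 0 (dist-onehot x< x<′ x≢) (dist-onehot y< y<′ y≢)
          (trans (cong (λ s → dist (onehot m s) (onehot m ((x′ + y′) % m))) e) (dist-refl (onehot m ((x′ + y′) % m)))))
  ... | no x≢ | no y≢ | no s≢ = inj₂ (total {x} {y} {x′} {y′} 2 2 2 (dist-onehot x< x<′ x≢) (dist-onehot y< y<′ y≢)
          (dist-onehot (m%n<n (x + y) m) (m%n<n (x′ + y′) m) s≢))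

-- The blocks {x, y, x + y, x − y}, with x − y shifted to stay nonnegative.
quadruple-code : ∀ m r → 3 ≤ m →
  ∃[ C ] (Is2DistCode {m + (m + ((m + m) + ((m + m) + r)))} 6 8 C × length C ≡ m * m)
quadruple-code m@(suc p@(suc (suc p″))) r (s≤s (s≤s (s≤s _))) = grid-code {h = 2} m w close
  (1 , 0 , s≤s (s≤s z≤n) , s≤s z≤n , total {0} {0} {1} {0} 2 0 2 2 (dist-onehot {m} (s≤s z≤n) (s≤s (s≤s z≤n)) λ ())
    (dist-refl (onehot m 0)) (dist-onehot {m + m} (s≤s z≤n) (s≤s (s≤s z≤n)) λ ())
    (dist-onehot (diff< {0} {0} (s≤s z≤n)) (diff< {1} {0} (s≤s (s≤s z≤n))) (λ e → 1+n≢n (sym e))))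
  -- The pair `(1 , 1)` would have the same difference as `(0 , 0)`. For `(1 , 2)` the sums are 0
  -- and 3 and the shifted differences are `p` and `p - 1`, so all four groups differ.
  (1 , 2 , s≤s (s≤s z≤n) , s≤s (s≤s (s≤s z≤n)) , total {0} {0} {1} {2} 2 2 2 2 (dist-onehot {m} (s≤s z≤n) (s≤s (s≤s z≤n)) λ ())
    (dist-onehot {m} (s≤s z≤n) (s≤s (s≤s (s≤s z≤n))) λ ())
    (dist-onehot {m + m} (s≤s z≤n) (s≤s (s≤s (s≤s (≤-trans (s≤s z≤n) (m≤n+m m p″))))) λ ())
    (dist-onehot (diff< {0} {0} (s≤s z≤n)) (diff< {1} {2} (s≤s (s≤s z≤n))) (1+n≢n)))
  (s≤s z≤n)
  where
  w : ℕ → ℕ → Word (m + (m + ((m + m) + ((m + m) + r))))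
  w x y = onehot m x ⧺ (onehot m y ⧺ (onehot (m + m) (x + y) ⧺ (onehot (m + m) (x + (p ∸ y)) ⧺ zeros)))
  diff< : ∀ {x y} → x < m → x + (p ∸ y) < m + m
  diff< {x} {y} x< = +-mono-<-≤ x< (≤-trans (m∸n≤m p y) (n≤1+n p))
  total : ∀ {x y x′ y′} d₁ d₂ d₃ d₄ → dist (onehot m x) (onehot m x′) ≡ d₁ → dist (onehot m y) (onehot m y′) ≡ d₂ →
    dist (onehot (m + m) (x + y)) (onehot (m + m) (x′ + y′)) ≡ d₃ →
    dist (onehot (m + m) (x + (p ∸ y))) (onehot (m + m) (x′ + (p ∸ y′))) ≡ d₄ →
    dist (w x y) (w x′ y′) ≡ d₁ + (d₂ + (d₃ + (d₄ + 0)))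
  total {x} {y} {x′} {y′} _ _ _ _ e₁ e₂ e₃ e₄ = trans (dist-++ (onehot m x) (onehot m x′) _ _) (cong₂ _+_ e₁
    (trans (dist-++ (onehot m y) (onehot m y′) _ _) (cong₂ _+_ e₂
      (trans (dist-++ (onehot (m + m) (x + y)) (onehot (m + m) (x′ + y′)) _ _) (cong₂ _+_ e₃
        (trans (dist-++ (onehot (m + m) (x + (p ∸ y))) (onehot (m + m) (x′ + (p ∸ y′))) (zeros {r}) zeros)
          (cong₂ _+_ e₄ (dist-refl (zeros {r})))))))))
  agree : ∀ k (s s′ : ℕ) → s ≡ s′ → dist (onehot k s) (onehot k s′) ≡ 0
  agree k s _ refl = dist-refl (onehot k s)
  -- Sum and shifted difference add up to `2 * x + p`, which determines `x`. The halving is valid in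
  -- ℕ but fails modulo an even `m`; hence these two groups are not reduced modulo `m` and take
  -- `m + m` points each, which makes the length about 6m.
  sum-diff : ∀ {x y x′ y′} → y < m → y′ < m → x + y ≡ x′ + y′ → x + (p ∸ y) ≡ x′ + (p ∸ y′) → x ≡ x′ × y ≡ y′
  sum-diff {x} {y} {x′} {y′} y< y<′ s d = x≡x′ , +-cancelˡ-≡ x y y′ (trans s (cong (_+ y′) (sym x≡x′)))
    where
    regroup : ∀ x y d → 2 * x + (y + d) ≡ (x + y) + (x + d)
    regroup = solve-∀
    x≡x′ : x ≡ x′
    x≡x′ = *-cancelˡ-≡ x x′ 2 (+-cancelʳ-≡ p (2 * x) (2 * x′) (begin
      2 * x + p                     ≡⟨ cong (2 * x +_) (sym (m+[n∸m]≡n (≤-pred y<))) ⟩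
      2 * x + (y + (p ∸ y))         ≡⟨ regroup x y (p ∸ y) ⟩
      (x + y) + (x + (p ∸ y))       ≡⟨ cong₂ _+_ s d ⟩
      (x′ + y′) + (x′ + (p ∸ y′))   ≡⟨ sym (regroup x′ y′ (p ∸ y′)) ⟩
      2 * x′ + (y′ + (p ∸ y′))      ≡⟨ cong (2 * x′ +_) (m+[n∸m]≡n (≤-pred y<′)) ⟩
      2 * x′ + p                    ∎))
      where open ≡-Reasoning
  close : ∀ {x y x′ y′} → x < m → y < m → x′ < m → y′ < m → ¬ (x ≡ x′ × y ≡ y′) → TwoDist 3 (w x y) (w x′ y′)
  close {x} {y} {x′} {y′} x< y< x<′ y<′ ne
    with x ≟ x′ | y ≟ y′ | x + y ≟ x′ + y′ | x + (p ∸ y) ≟ x′ + (p ∸ y′)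
  ... | yes ex | yes ey | _      | _      = contradiction (ex , ey) ne
  ... | yes refl | no y≢ | yes e  | _      = contradiction (+-cancelˡ-≡ x y y′ e) y≢
  ... | yes refl | no y≢ | no _   | yes e  = contradiction
          (∸-cancelˡ-≡ (≤-pred y<) (≤-pred y<′) (+-cancelˡ-≡ x _ _ e)) y≢
  ... | no x≢ | yes refl | yes e  | _      = contradiction (+-cancelʳ-≡ y x x′ e) x≢
  ... | no x≢ | yes refl | no _   | yes e  = contradiction (+-cancelʳ-≡ (p ∸ y) x x′ e) x≢
  ... | no x≢ | no _     | yes s  | yes d  = contradiction (proj₁ (sum-diff y< y<′ s d)) x≢
  ... | yes ex | no y≢ | no s≢ | no d≢ = inj₁ (total {x} {y} {x′} {y′} 0 2 2 2 (agree m x x′ ex) (dist-onehot y< y<′ y≢)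
          (dist-onehot (+-mono-< x< y<) (+-mono-< x<′ y<′) s≢) (dist-onehot (diff< {x} {y} x<) (diff< {x′} {y′} x<′) d≢))
  ... | no x≢ | yes ey | no s≢ | no d≢ = inj₁ (total {x} {y} {x′} {y′} 2 0 2 2 (dist-onehot x< x<′ x≢) (agree m y y′ ey)
          (dist-onehot (+-mono-< x< y<) (+-mono-< x<′ y<′) s≢) (dist-onehot (diff< {x} {y} x<) (diff< {x′} {y′} x<′) d≢))
  ... | no x≢ | no y≢ | yes es | no d≢ = inj₁ (total {x} {y} {x′} {y′} 2 2 0 2 (dist-onehot x< x<′ x≢) (dist-onehot y< y<′ y≢)
          (agree (m + m) (x + y) (x′ + y′) es) (dist-onehot (diff< {x} {y} x<) (diff< {x′} {y′} x<′) d≢))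
  ... | no x≢ | no y≢ | no s≢ | yes ed = inj₁ (total {x} {y} {x′} {y′} 2 2 2 0 (dist-onehot x< x<′ x≢) (dist-onehot y< y<′ y≢)
          (dist-onehot (+-mono-< x< y<) (+-mono-< x<′ y<′) s≢) (agree (m + m) (x + (p ∸ y)) (x′ + (p ∸ y′)) ed))
  ... | no x≢ | no y≢ | no s≢ | no d≢ = inj₂ (total {x} {y} {x′} {y′} 2 2 2 2 (dist-onehot x< x<′ x≢) (dist-onehot y< y<′ y≢)
          (dist-onehot (+-mono-< x< y<) (+-mono-< x<′ y<′) s≢) (dist-onehot (diff< {x} {y} x<) (diff< {x′} {y′} x<′) d≢))

-- Large optimal codes

structure-bound triple-bound : ℕ → ℕ → ℕ
triple-bound h n = 12 * h + 4 * (n + cube (2 ^ h) * h)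
structure-bound h n = 3 * suc h * n + (h + (cube (suc h) * n + cube (2 ^ suc h) * h))

large-optimal⇒constant-weight : ∀ h → 2 ≤ h → h ≤ 3 → (C : Code n) → Optimal (h + h) (h + h + 2) C → far-bound h < n →
  triple-bound h n < length C * h → structure-bound h n < length C * h → ∃[ y ] ConstWeight (suc h) (translate y C)
large-optimal⇒constant-weight {n} h@(suc h₁@(suc _)) (s≤s (s≤s _)) h≤3 C ((C-unique , C-dist , _) , maximal)
  large no-small₁ no-small₂ =
  m , All.tabulate λ {w} w∈ → all-good w w∈
  where
  triple : FarTriple h C
  triple with far-triple-or-small C (unique⇒allPairs C-unique C-dist)
  ... | inj₁ t = t
  ... | inj₂ l = contradiction l (<⇒≱ no-small₁)

  x = proj₁ triple
  y = proj₁ (proj₂ triple)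
  z = proj₁ (proj₂ (proj₂ triple))
  members = proj₂ (proj₂ (proj₂ triple))
  dists = proj₂ (proj₂ (proj₂ members))

  open Centre (centre-of-triple (suc h) x y z (proj₁ dists) (proj₁ (proj₂ dists)) (proj₂ (proj₂ dists)))
    renaming (centre to m)

  T : List (Word n)
  T = translate m C

  length-T : length T ≡ length C
  length-T = length-map (_⊕ m) C

  ⊕-injective : ∀ {v w : Word n} → v ⊕ m ≡ w ⊕ m → v ≡ w
  ⊕-injective {v} {w} e = cancel v w m e
    where
    xor-cancel : ∀ a b c → a xor c ≡ b xor c → a ≡ b
    xor-cancel true  true  c e = refl
    xor-cancel true  false true ()
    xor-cancel true  false false ()
    xor-cancel false true  true ()
    xor-cancel false true  false ()
    xor-cancel false false c e = refl
    cancel : ∀ {n} (v w m : Word n) → v ⊕ m ≡ w ⊕ m → v ≡ w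
    cancel []      []      []      e = refl
    cancel (a ∷ v) (b ∷ w) (c ∷ m) e = cong₂ _∷_ (xor-cancel a b c (Vec.∷-injectiveˡ e)) (cancel v w m (Vec.∷-injectiveʳ e))

  T-dist : ∀ v w → v ∈ T → w ∈ T → v ≢ w → TwoDist h v w
  T-dist v w v∈ w∈ v≢w with ∈-map⁻ (_⊕ m) v∈ | ∈-map⁻ (_⊕ m) w∈
  ... | v′ , v∈′ , refl | w′ , w∈′ , refl =
    subst (λ d → d ≡ h + h ⊎ d ≡ h + h + 2) (sym (dist-translate v′ w′ m)) (C-dist v′ w′ v∈′ w∈′ λ { refl → v≢w refl })

  in-T : ∀ {v} → v ∈ C → v ⊕ m ∈ T
  in-T = ∈-map⁺ (_⊕ m)

  open Structure {n} {h} T T-dist (Unique.map⁺ ⊕-injective C-unique) (x ⊕ m) (y ⊕ m) (z ⊕ m)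
    (in-T (proj₁ members)) (in-T (proj₁ (proj₂ members))) (in-T (proj₁ (proj₂ (proj₂ members))))
    wt₁ wt₂ wt₃ dis₁₂ dis₁₃ dis₂₃

  no-bad : bad ≡ []
  no-bad with bad-or-small
  ... | inj₁ e = e
  ... | inj₂ l = contradiction (subst (λ k → k * h ≤ structure-bound h n) length-T l) (<⇒≱ no-small₂)

  good-∈ : ∀ {v} → v ∈ C → wt (v ⊕ m) ≡ suc h → v ⊕ m ∈ good
  good-∈ v∈ wv = ∈-filter⁺ good? (in-T v∈) wv

  no-low : ∀ {w} → ¬ w ∈ low
  no-low {w} w∈ = <⇒≱ too-long (maximal augmented augmented-code)
    where
    w∈T = proj₁ (∈-filter⁻ (λ w → ¬? (good? w)) {xs = T} (proj₁ (∈-filter⁻ low? {xs = notGood} w∈)))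
    low-w = proj₂ (∈-filter⁻ low? {xs = notGood} w∈)
    good-T : ∀ {v} → v ∈ good → v ∈ T × Good v
    good-T v∈ = ∈-filter⁻ good? v∈
    disjoint : ∀ {v} → v ∈ good → Disjoint w v
    disjoint {v} v∈ = low-meets-nothing h w v low-w (proj₂ (good-T v∈)) (T-dist w v w∈T (proj₁ (good-T v∈))
      λ { refl → proj₂ (∈-filter⁻ (λ w → ¬? (good? w)) {xs = T} (proj₁ (∈-filter⁻ low? {xs = notGood} w∈))) (proj₂ (good-T v∈)) })
    -- The low word has weight h-1, which is positive since h ≥ 2.
    p = nonempty w λ e → contradiction (trans (sym low-w) (cong suc e)) λ ()
    open Augment {n} {h₁} h≤3 good (Unique.filter⁺ good? (Unique.map⁺ ⊕-injective C-unique))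
      (λ v v′ v∈ v∈′ → T-dist v v′ (proj₁ (good-T v∈)) (proj₁ (good-T v∈′)))
      (λ v∈ → proj₂ (good-T v∈)) w low-w disjoint (proj₁ p) (proj₂ p)
      (x ⊕ m) (y ⊕ m) (good-∈ (proj₁ members) wt₁) (good-∈ (proj₁ (proj₂ members)) wt₂) dis₁₂ large
    open Result configuration
    too-long : length C < length augmented
    too-long = begin-strict
      length C                               ≡⟨ sym length-T ⟩
      length T                               ≡⟨ length-C ⟩
      length good + (length low + length bad) ≡⟨ cong (λ L → length good + (length low + length L)) no-bad ⟩
      length good + (length low + 0)         ≤⟨ +-monoʳ-≤ (length good) (≤-trans (≤-reflexive (+-identityʳ _)) low-bound) ⟩
      length good + 1                        <⟨ ≤-reflexive (sym (trans (+-comm 2 (length good)) (+-suc _ 1))) ⟩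
      2 + length good                        ≡⟨ sym augmented-length ⟩
      length augmented                       ∎
      where open ≤-Reasoning

  all-good : ∀ w → w ∈ T → wt w ≡ suc h
  all-good w w∈ with good? w
  ... | yes g = g
  ... | no ¬g with low? w
  ...   | yes l = contradiction (∈-filter⁺ low? (∈-filter⁺ (λ w → ¬? (good? w)) w∈ ¬g) l) no-low
  ...   | no ¬l = contradiction (subst (w ∈_) no-bad
            (∈-filter⁺ (λ w → ¬? (low? w)) (∈-filter⁺ (λ w → ¬? (good? w)) w∈ ¬g) ¬l)) λ ()

-- Linear bounds against quadratic codes

slope offset : ℕ → ℕ
slope h = 3 * suc h + cube (suc h)
offset h = h + cube (2 ^ suc h) * h

structure-bound-linear : ∀ h n → structure-bound h n ≡ slope h * n + offset h
structure-bound-linear h n = regroup (3 * suc h) (cube (suc h)) h (cube (2 ^ suc h) * h) n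
  where
  regroup : ∀ a b c d n → a * n + (c + (b * n + d)) ≡ (a + b) * n + (c + d)
  regroup = solve-∀

-- Exceeding `structure-bound` is then the only demand on the size of the code.
triple≤structure : ∀ h n → 4 ≤ slope h → 12 * h + 4 * (cube (2 ^ h) * h) ≤ offset h → triple-bound h n ≤ structure-bound h n
triple≤structure h n s o = begin
  12 * h + 4 * (n + cube (2 ^ h) * h)         ≡⟨ regroup h n (cube (2 ^ h) * h) ⟩
  4 * n + (12 * h + 4 * (cube (2 ^ h) * h))   ≤⟨ +-mono-≤ (*-monoˡ-≤ n s) o ⟩
  slope h * n + offset h                      ≡⟨ sym (structure-bound-linear h n) ⟩
  structure-bound h n                         ∎
  where
  open ≤-Reasoning
  regroup : ∀ h n e → 12 * h + 4 * (n + e) ≡ 4 * n + (12 * h + 4 * e)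
  regroup = solve-∀

-- The number `e` is a surplus of `q * h` over `slope h * d`; taken `m` times, it absorbs all terms
-- that are constant in `m`.
structure-bound<square : ∀ h {n m} d r q e → n ≤ d * m + r → q ≤ m →
  slope h * r + offset h < e * q → slope h * d + e ≤ q * h → structure-bound h n < m * m * h
structure-bound<square h {n} {m} d r q e n≤ q≤m small steep = begin-strict
  structure-bound h n                             ≡⟨ structure-bound-linear h n ⟩
  slope h * n + offset h                          ≤⟨ +-monoˡ-≤ _ (*-monoʳ-≤ (slope h) n≤) ⟩
  slope h * (d * m + r) + offset h                ≡⟨ expand (slope h) d m r (offset h) ⟩
  slope h * d * m + (slope h * r + offset h)      <⟨ +-monoʳ-< (slope h * d * m) small ⟩
  slope h * d * m + e * q                         ≤⟨ +-monoʳ-≤ (slope h * d * m) (*-monoʳ-≤ e q≤m) ⟩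
  slope h * d * m + e * m                         ≡⟨ sym (*-distribʳ-+ m (slope h * d) e) ⟩
  (slope h * d + e) * m                           ≤⟨ *-monoˡ-≤ m (≤-trans steep (*-monoˡ-≤ h q≤m)) ⟩
  m * h * m                                       ≡⟨ swap m h ⟩
  m * m * h                                       ∎
  where
  open ≤-Reasoning
  expand : ∀ s d m r o → s * (d * m + r) + o ≡ s * d * m + (s * r + o)
  expand = solve-∀
  swap : ∀ m h → m * h * m ≡ m * m * h
  swap = solve-∀

division : ∀ q d .{{_ : NonZero d}} {n} → q * d ≤ n → ∃[ m ] ∃[ r ] (q ≤ m × r < d × n ≡ d * m + r)
division q d {n} l = n / d , n % d , ≤-trans (≤-reflexive (sym (m*n/n≡m q d))) (/-monoˡ-≤ d l) , m%n<n n d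
  , trans (m≡m%n+[m/n]*n n d) (trans (+-comm (n % d) _) (cong (_+ n % d) (*-comm (n / d) d)))

-- Here `suc d` is the number of points of the design per unit of `m`, so at most `d` coordinates
-- are left over. An optimal code has at least the `m * m` words of the design, and this exceeds the
-- linear bound as soon as `m` reaches `q`.
goodFrom : ∀ h d q e N → 2 ≤ h → h ≤ 3 → q * suc d ≤ N → far-bound h < N →
  4 ≤ slope h → 12 * h + 4 * (cube (2 ^ h) * h) ≤ offset h →
  slope h * d + offset h < e * q → slope h * suc d + e ≤ q * h →
  (∀ m r → q ≤ m → ∃[ C ] (Is2DistCode {suc d * m + r} (h + h) (h + h + 2) C × length C ≡ m * m)) →
  GoodFrom h N
goodFrom h@(suc _) d q e N 2≤h h≤3 qd≤N large s o small steep code n n≥N C opt =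
  large-optimal⇒constant-weight h 2≤h h≤3 C opt (<-≤-trans large n≥N)
    (≤-<-trans (triple≤structure h n s o) big) big
  where
  big : structure-bound h n < length C * h
  big with division q (suc d) (≤-trans qd≤N n≥N)
  ... | m , r , q≤m , s≤s r≤d , refl with code m r q≤m
  ...   | C′ , isCode , len = <-≤-trans
    (structure-bound<square h (suc d) d q e (+-monoʳ-≤ (suc d * m) r≤d) q≤m small steep)
    (*-monoˡ-≤ h (≤-trans (≤-reflexive (sym len)) (proj₂ opt C′ isCode)))

cast-code : ∀ {h k n n′ l} → n ≡ n′ → ∃[ C ] (Is2DistCode {n} h k C × length C ≡ l) →
  ∃[ C ] (Is2DistCode {n′} h k C × length C ≡ l)
cast-code refl p = p

-- The constants: n = (d + 1) m + r with r ≤ d gives m ≥ q, and e = q h − slope h (d + 1).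
theorem3 : GoodFrom 2 302 × GoodFrom 3 1685
theorem3 =
    goodFrom 2 2 100 92 302
      (≤ᵇ⇒≤ _ _ tt) (≤ᵇ⇒≤ _ _ tt) (≤ᵇ⇒≤ _ _ tt) (≤ᵇ⇒≤ _ _ tt)
      (≤ᵇ⇒≤ _ _ tt) (≤ᵇ⇒≤ _ _ tt) (≤ᵇ⇒≤ _ _ tt) (≤ᵇ⇒≤ _ _ tt)
      (λ m r l → cast-code (three m r) (triple-code m r (≤-trans (≤ᵇ⇒≤ 3 100 tt) l)))
  , goodFrom 3 5 280 384 1685
      (≤ᵇ⇒≤ _ _ tt) (≤ᵇ⇒≤ _ _ tt) (≤ᵇ⇒≤ _ _ tt) (≤ᵇ⇒≤ _ _ tt)
      (≤ᵇ⇒≤ _ _ tt) (≤ᵇ⇒≤ _ _ tt) (≤ᵇ⇒≤ _ _ tt) (≤ᵇ⇒≤ _ _ tt)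
      (λ m r l → cast-code (six m r) (quadruple-code m r (≤-trans (≤ᵇ⇒≤ 3 280 tt) l)))
  where
  three : ∀ m r → m + (m + (m + r)) ≡ 3 * m + r
  three = solve-∀
  six : ∀ m r → m + (m + ((m + m) + ((m + m) + r))) ≡ 6 * m + r
  six = solve-∀
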